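{- Let $\mathcal H$ be a cluster of graphs and let $g\ge 0$ be an integer such that $\mathrm{gen}(\bigcup\mathcal H)>g$. Then there is a subcollection $\mathcal H_g\subseteq\mathcal H$ with $|\mathcal H_g|\le 4g+5$ such that $\mathrm{gen}(\bigcup\mathcal H_g)>g$.
   Context: All surfaces are compact and orientable; $\Sigma_g$ denotes the one of genus $g$. A cluster of graphs is a finite collection $\mathcal H$ of pairwise edge-disjoint connected graphs simultaneously embedded in one surface (so that their union $\bigcup\mathcal H$ is an embedded graph), such that some $H\in\mathcal H$ (an anchor) intersects (shares at least one vertex with) every graph in $\mathcal H$. For a subfamily $\mathcal F$, $\bigcup\mathcal F$ is the embedded graph that is the union of its members. The rotation at a vertex of an embedded graph is the clockwise cyclic order of its incident edges; two embedded graphs are isomorphic if there is an isomorphism of the underlying abstract graphs mapping the rotation at each vertex to the rotation at its image. The genus $\mathrm{gen}(G)$ of an embedded graph $G$ is the least $g$ such that $G$ is isomorphic (as an embedded graph) to a graph embedded in $\Sigma_g$; for connected $G$ with vertex set $V$, edge set $E$ and set of facial walks $\mathcal W$ (determined by the rotations), $\mathrm{gen}(G)=\tfrac12(2-|V|+|E|-|\mathcal W|)$. -}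

module Defs where

open import Data.Nat using (ℕ; zero; suc; _+_; _*_; _∸_; _≤ᵇ_)
open import Data.Nat.DivMod using (_/_)
open import Data.Bool using (Bool; true; false; _∧_; _∨_; not; if_then_else_; T)
open import Data.Fin using (Fin; toℕ)
import Data.Fin as Fin
import Data.Bool.Properties as BoolP
open import Data.Product using (Σ; _×_; _,_; proj₁; proj₂; ∃)
open import Data.List using (List; []; _∷_; length; filterᵇ; allFin)
open import Data.Bool.ListAction using (any; all)
open import Data.List.Membership.Propositional using (_∈_)
open import Data.List.Relation.Unary.Unique.Propositional using (Unique)
open import Relation.Nullary.Decidable using (⌊_⌋)
open import Relation.Binary.PropositionalEquality using (_≡_)
open import Function.Bundles using (_⇔_)

-- Combinatorial encoding of a graph embedded in an orientable surface
-- (rotation system).  Vertices are Fin n, edges are Fin m (loops and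
-- parallel edges allowed).  Each edge e has two darts (half-edges)
-- (e , false) and (e , true), attached at proj₁ (ends e) and
-- proj₂ (ends e) respectively.  The rotation at a vertex v is the
-- cyclic list  rot v  of the darts incident with v.

Dart : ℕ → Set
Dart m = Fin m × Bool

endOf : ∀ {n m} → (Fin m → Fin n × Fin n) → Dart m → Fin n
endOf ends (e , false) = proj₁ (ends e)
endOf ends (e , true)  = proj₂ (ends e)

record EmbeddedGraph (n m : ℕ) : Set where
  field
    ends : Fin m → Fin n × Fin n
    rot  : Fin n → List (Dart m)
    rot-complete : ∀ v d → (d ∈ rot v) ⇔ (endOf ends d ≡ v)
    rot-unique   : ∀ v → Unique (rot v)

_==ᶠ_ : ∀ {n} → Fin n → Fin n → Bool
a ==ᶠ b = ⌊ a Fin.≟ b ⌋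

_==ᵈ_ : ∀ {m} → Dart m → Dart m → Bool
(e , b) ==ᵈ (e' , b') = (e ==ᶠ e') ∧ ⌊ b BoolP.≟ b' ⌋

count : ∀ {n} → (Fin n → Bool) → ℕ
count {n} p = length (filterᵇ p (allFin n))

allDarts : ∀ m → List (Dart m)
allDarts m = Data.List.concatMap (λ e → (e , false) ∷ (e , true) ∷ []) (allFin m)
  where import Data.List

rank : ∀ {m} → Dart m → ℕ
rank (e , false) = 2 * toℕ e
rank (e , true)  = suc (2 * toℕ e)

-- cyclic successor of d in a cyclic list (d itself if absent)
next : ∀ {m} → List (Dart m) → Dart m → Dart m
next {m} [] d = d
next {m} (x₀ ∷ xs) d = go x₀ xs
  where
  go : Dart m → List (Dart m) → Dart m
  go x [] = if x ==ᵈ d then x₀ else d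
  go x (y ∷ ys) = if x ==ᵈ d then y else go y ys

iter : ∀ {A : Set} → ℕ → (A → A) → A → A
iter zero f a = a
iter (suc k) f a = f (iter k f a)

-- Subgraphs: a vertex set VS and an edge set ES (Boolean predicates),
-- with the induced rotation system (restriction of each cyclic order).

module _ {n m : ℕ} (G : EmbeddedGraph n m)
         (VS : Fin n → Bool) (ES : Fin m → Bool) where
  open EmbeddedGraph G

  rotS : Fin n → List (Dart m)
  rotS v = filterᵇ (λ d → ES (proj₁ d)) (rot v)

  -- vertex permutation σ, edge involution α, face permutation φ = σ ∘ α
  σ : Dart m → Dart m
  σ d = next (rotS (endOf ends d)) d

  α : Dart m → Dart m
  α (e , b) = (e , not b)

  φ : Dart m → Dart m
  φ d = σ (α d)

  faceRep : Dart m → Bool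
  faceRep d = ES (proj₁ d) ∧
    all (λ k → rank d ≤ᵇ rank (iter k φ d)) (Data.List.upTo (2 * m))
    where import Data.List

  numEdges : ℕ
  numEdges = count ES

  numVertices : ℕ
  numVertices = count VS

  isolated : Fin n → Bool
  isolated v = VS v ∧ all (λ e → not (ES e ∧ ((proj₁ (ends e) ==ᶠ v) ∨ (proj₂ (ends e) ==ᶠ v)))) (allFin m)

  -- number of facial walks: face orbits of darts, plus one face for
  -- each isolated vertex
  numFaces : ℕ
  numFaces = length (filterᵇ faceRep (allDarts m)) + count isolated

  reach : ℕ → Fin n → Fin n → Bool
  reach zero u v = u ==ᶠ v
  reach (suc k) u v = reach k u v ∨
    any (λ e → ES e ∧ ((reach k u (proj₁ (ends e)) ∧ (proj₂ (ends e) ==ᶠ v))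
                    ∨ (reach k u (proj₂ (ends e)) ∧ (proj₁ (ends e) ==ᶠ v))))
        (allFin m)

  connected : Fin n → Fin n → Bool
  connected u v = reach n u v

  compRep : Fin n → Bool
  compRep v = VS v ∧ all (λ u → not (VS u ∧ connected u v) ∨ (toℕ v ≤ᵇ toℕ u)) (allFin n)

  numComponents : ℕ
  numComponents = count compRep

  -- genus: (2c - |V| + |E| - |W|)/2, i.e. the sum over components of
  -- the formula gen = (2 - |V| + |E| - |W|)/2 from the paper
  genus : ℕ
  genus = (2 * numComponents + numEdges ∸ (numVertices + numFaces)) / 2

-- Clusters.  A family of k graphs H_i (i : Fin k) in the embedded graph G:
-- edge e belongs to H_(lab e) (so the H_i are pairwise edge-disjoint),
-- and H_i has vertex set { v | mem i v ≡ true }.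

record Cluster {n m : ℕ} (G : EmbeddedGraph n m) (k : ℕ) : Set where
  open EmbeddedGraph G
  field
    lab : Fin m → Fin k
    mem : Fin k → Fin n → Bool
    ends-mem : ∀ e → T (mem (lab e) (proj₁ (ends e))) × T (mem (lab e) (proj₂ (ends e)))
    nonempty : ∀ i → ∃ λ v → T (mem i v)
    conn : ∀ i u v → T (mem i u) → T (mem i v) →
           T (connected G (mem i) (λ e → ⌊ lab e Fin.≟ i ⌋) u v)
    anchor : ∃ λ a → ∀ i → ∃ λ v → T (mem a v) × T (mem i v)

module _ {n m k : ℕ} {G : EmbeddedGraph n m} (H : Cluster G k) where
  open Cluster H
  unionV : (Fin k → Bool) → Fin n → Bool
  unionV S v = any (λ i → S i ∧ mem i v) (allFin k)

  unionE : (Fin k → Bool) → Fin m → Bool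
  unionE S e = S (lab e)

  genusUnion : (Fin k → Bool) → ℕ
  genusUnion S = genus G (unionV S) (unionE S)

{-# OPTIONS --safe #-}
-- Twice the genus of an embedded graph is the rank of the intersection form modulo 2 on its cycle space:
-- the radical of the form consists of the boundaries of sums of faces, so the rank is
-- (|E| - |V| + c) - (|W| - c) by counting dimensions.  Since every member of a cluster meets the anchor, the cycle
-- space of the union is generated by cycles lying in the union of the anchor and at most two further members.
-- If the rank exceeds 2g, then g + 1 hyperbolic pairs can be split off one after the other among these generators
-- (the form is alternating); the 2g + 2 generators involve at most 2(2g + 2) members besides the anchor, and the form is
-- nondegenerate on them.
module Submission where

open import Defs
open import Level using (0ℓ)
open import Algebra.Bundles using (CommutativeMonoid; CommutativeRing)
open import Algebra.Structures using (IsCommutativeMonoid)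
open import Data.Bool using (Bool; true; false; _∧_; _∨_; _xor_; not; if_then_else_; T; T?)
open import Data.Bool.Properties as BoolP
  using (xor-∧-commutativeRing; T-≡; T-∧; T-∨; xor-same; xor-assoc; xor-identityʳ; ∧-zeroʳ; ∧-identityʳ; ∧-comm)
open import Data.Bool.Solver using (module xor-∧-Solver)
open import Data.Bool.ListAction using (any)
open import Data.Empty using (⊥; ⊥-elim)
open import Data.Fin as Fin using (Fin; zero; suc; toℕ)
import Data.Fin.Properties as FinP
open import Data.List using (List; []; _∷_; _++_; map; length; lookup; foldr; filterᵇ; allFin; upTo; tabulate)
import Data.List.Properties as ListP
open import Data.List.Membership.Propositional using (_∈_; lose)
open import Data.List.Membership.Propositional.Properties
open import Data.List.Relation.Unary.All as All using (All; []; _∷_)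
import Data.List.Relation.Unary.All.Properties as AllP
open import Data.List.Relation.Unary.AllPairs using ([]; _∷_)
open import Data.List.Relation.Unary.Any as Any using (Any; here; there)
import Data.List.Relation.Unary.Any.Properties as AnyP
open import Data.List.Relation.Unary.Unique.Propositional using (Unique)
import Data.List.Relation.Unary.Unique.Propositional.Properties as UniqueP
open import Data.Nat.DivMod using (/-monoˡ-≤; m*n/n≡m)
open import Data.Nat as ℕ using (ℕ; zero; suc; _+_; _*_; _^_; _∸_; _≤_; _<_; _>_; z≤n; s≤s)
import Data.Nat.Properties as ℕP
open import Data.Nat.Solver using (module +-*-Solver)
open import Data.Product using (Σ; ∃; _×_; _,_; proj₁; proj₂)
open import Data.Sum as Sum using (_⊎_; inj₁; inj₂)
open import Data.Product.Properties using () renaming (≡-dec to ×-≡-dec)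
open import Data.Sum.Properties using () renaming (≡-dec to ⊎-≡-dec)
open import Function using (_∘_; id)
open import Function.Bundles using (Equivalence)
open import Relation.Binary.Definitions using (DecidableEquality)
open import Relation.Binary.PropositionalEquality hiding (resp)
open import Relation.Nullary using (¬_; Dec; yes; no; does; contradiction)
open import Relation.Nullary.Decidable using (⌊_⌋; _→-dec_; _×-dec_)
open ≡-Reasoning

-- No rank is computed and no basis is chosen. Spaces are compared by counting: an injective map
-- between spaces of Boolean functions gives 2^a ≤ 2^b. For a connected union this yields two
-- one-sided estimates: r cycles on which the form is nondegenerate give r + |V| + |W| ≤ |E| + 2,
-- and r cycles that span modulo the radical give the reverse. The first is applied to the chosen
-- subfamily, the second to the whole cluster, and the dichotomy in `select` takes the place of the
-- rank. For the same cycles to serve in both estimates, the form must not depend on the subfamily.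
-- It is therefore defined once, from the rotations of the ambient graph; deleting darts outside the
-- support of a chain does not affect it. A fundamental cycle of an edge may involve three members
-- besides the anchor: that of the edge and one for the path to each end. Taken as generators, these
-- cycles would give a larger constant; they are split into cycles that involve at most two.

T⇒≡ : ∀ {b} → T b → b ≡ true
T⇒≡ = Equivalence.to T-≡

≡⇒T : ∀ {b} → b ≡ true → T b
≡⇒T = Equivalence.from T-≡

iff⇒≡ : ∀ {a b} → (T a → T b) → (T b → T a) → a ≡ b
iff⇒≡ {false} {false} _ _ = refl
iff⇒≡ {true}  {true}  _ _ = refl
iff⇒≡ {true}  {false} f _ = ⊥-elim (f _)
iff⇒≡ {false} {true}  _ g = ⊥-elim (g _)

xor≡false⇒≡ : ∀ {a b} → a xor b ≡ false → a ≡ b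
xor≡false⇒≡ {false} {false} _ = refl
xor≡false⇒≡ {true}  {true}  _ = refl

≡⇒xor≡false : ∀ {a b} → a ≡ b → a xor b ≡ false
≡⇒xor≡false {a} refl = xor-same a

==ᶠ⇒≡ : ∀ {n} {a b : Fin n} → T (a ==ᶠ b) → a ≡ b
==ᶠ⇒≡ {a = a} {b} p with a Fin.≟ b
... | yes eq = eq

==ᶠ-refl : ∀ {n} (a : Fin n) → (a ==ᶠ a) ≡ true
==ᶠ-refl a with a Fin.≟ a
... | yes _ = refl
... | no ¬p = contradiction refl ¬p

==ᶠ-suc : ∀ {n} (a b : Fin n) → (Fin.suc a ==ᶠ suc b) ≡ (a ==ᶠ b)
==ᶠ-suc a b with a Fin.≟ b
... | yes _ = refl
... | no  _ = refl

≡⇒==ᶠ : ∀ {n} {a b : Fin n} → a ≡ b → T (a ==ᶠ b)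
≡⇒==ᶠ {a = a} refl = ≡⇒T (==ᶠ-refl a)

==ᵈ⇒≡ : ∀ {m} {d d' : Dart m} → T (d ==ᵈ d') → d ≡ d'
==ᵈ⇒≡ {d = e , b} {e' , b'} p with Equivalence.to (T-∧ {e ==ᶠ e'}) p
... | p₁ , p₂ with b BoolP.≟ b'
...   | yes refl = cong (_, b) (==ᶠ⇒≡ p₁)

==ᵈ-refl : ∀ {m} (d : Dart m) → (d ==ᵈ d) ≡ true
==ᵈ-refl (e , false) rewrite ==ᶠ-refl e = refl
==ᵈ-refl (e , true)  rewrite ==ᶠ-refl e = refl

≢⇒==ᵈ : ∀ {m} {d d' : Dart m} → d ≢ d' → (d ==ᵈ d') ≡ false
≢⇒==ᵈ {d = d} {d'} d≢d' with d ==ᵈ d' in eq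
... | false = refl
... | true  = contradiction (==ᵈ⇒≡ (≡⇒T eq)) d≢d'

-- Sums over darts

module DartSum {C : Set} {_⊹_ : C → C → C} {0# : C}
               (isCM : IsCommutativeMonoid _≡_ _⊹_ 0#) where

  monoid : CommutativeMonoid 0ℓ 0ℓ
  monoid = record { isCommutativeMonoid = isCM }

  open CommutativeMonoid monoid using (identityˡ; identityʳ; assoc; comm)
  open import Algebra.Properties.CommutativeMonoid.Sum monoid public
    using (sum; ∑-distrib-+; ∑-comm; sum-replicate-zero)
    renaming (sum-cong-≗ to sum-cong)

  mask : Bool → C → C
  mask b c = if b then c else 0#

  ∑ᵈ : ∀ {m} → (Dart m → C) → C
  ∑ᵈ h = sum λ e → h (e , false) ⊹ h (e , true)

  ∑ˡ : ∀ {A : Set} → List A → (A → C) → C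
  ∑ˡ xs h = foldr (λ d → h d ⊹_) 0# xs

  ∑ᵈ-cong : ∀ {m} {h h' : Dart m → C} → h ≗ h' → ∑ᵈ h ≡ ∑ᵈ h'
  ∑ᵈ-cong eq = sum-cong λ e → cong₂ _⊹_ (eq (e , false)) (eq (e , true))

  interchange : ∀ a b c d → (a ⊹ b) ⊹ (c ⊹ d) ≡ (a ⊹ c) ⊹ (b ⊹ d)
  interchange a b c d = begin
    (a ⊹ b) ⊹ (c ⊹ d) ≡⟨ assoc a b (c ⊹ d) ⟩
    a ⊹ (b ⊹ (c ⊹ d)) ≡⟨ cong (a ⊹_) (assoc b c d) ⟨
    a ⊹ ((b ⊹ c) ⊹ d) ≡⟨ cong (λ x → a ⊹ (x ⊹ d)) (comm b c) ⟩
    a ⊹ ((c ⊹ b) ⊹ d) ≡⟨ cong (a ⊹_) (assoc c b d) ⟩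
    a ⊹ (c ⊹ (b ⊹ d)) ≡⟨ assoc a c (b ⊹ d) ⟨
    (a ⊹ c) ⊹ (b ⊹ d) ∎

  ∑ᵈ-distrib : ∀ {m} (h h' : Dart m → C) → ∑ᵈ (λ d → h d ⊹ h' d) ≡ ∑ᵈ h ⊹ ∑ᵈ h'
  ∑ᵈ-distrib h h' = trans
    (sum-cong λ e → interchange (h (e , false)) _ _ _)
    (∑-distrib-+ (λ e → h (e , false) ⊹ h (e , true)) _)

  ∑ˡ-cong : ∀ {A : Set} (xs : List A) {h h' : A → C} →
            (∀ {d} → d ∈ xs → h d ≡ h' d) → ∑ˡ xs h ≡ ∑ˡ xs h'
  ∑ˡ-cong []       eq = refl
  ∑ˡ-cong (x ∷ xs) eq = cong₂ _⊹_ (eq (here refl)) (∑ˡ-cong xs (eq ∘ there))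

  sum-zero : ∀ {n} {h : Fin n → C} → (∀ i → h i ≡ 0#) → sum h ≡ 0#
  sum-zero {n} eq = trans (sum-cong eq) (sum-replicate-zero n)

  sum-single : ∀ {n} (u : Fin n) (h : Fin n → C) → sum (λ v → mask (u ==ᶠ v) (h v)) ≡ h u
  sum-single {suc n} zero h = trans (cong (h zero ⊹_) (sum-zero {n} λ _ → refl)) (identityʳ _)
  sum-single (suc u) h = begin
    0# ⊹ sum (λ v → mask (suc u ==ᶠ suc v) (h (suc v))) ≡⟨ identityˡ _ ⟩
    sum (λ v → mask (suc u ==ᶠ suc v) (h (suc v)))
      ≡⟨ sum-cong (λ v → cong (λ b → mask b (h (suc v))) (==ᶠ-suc u v)) ⟩
    sum (λ v → mask (u ==ᶠ v) (h (suc v)))              ≡⟨ sum-single u (h ∘ suc) ⟩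
    h (suc u)                                           ∎

  ∑ᵈ-single : ∀ {m} (d : Dart m) (h : Dart m → C) → ∑ᵈ (λ d' → mask (d ==ᵈ d') (h d')) ≡ h d
  ∑ᵈ-single (e , false) h = trans
    (sum-cong λ e' → lem (e ==ᶠ e') (h (e' , false)) (h (e' , true)))
    (sum-single e (λ e' → h (e' , false)))
    where
    lem : ∀ b c c' → mask (b ∧ true) c ⊹ mask (b ∧ false) c' ≡ mask b c
    lem false c c' = identityʳ 0#
    lem true  c c' = identityʳ c
  ∑ᵈ-single (e , true) h = trans
    (sum-cong λ e' → lem (e ==ᶠ e') (h (e' , false)) (h (e' , true)))
    (sum-single e (λ e' → h (e' , true)))
    where
    lem : ∀ b c c' → mask (b ∧ false) c ⊹ mask (b ∧ true) c' ≡ mask b c'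
    lem false c c' = identityʳ 0#
    lem true  c c' = identityˡ c'

  member : ∀ {m} → List (Dart m) → Dart m → Bool
  member xs d = any (_==ᵈ d) xs

  member⇒∈ : ∀ {m} {xs : List (Dart m)} {d} → T (member xs d) → d ∈ xs
  member⇒∈ {xs = xs} p = Any.map (λ q → sym (==ᵈ⇒≡ q)) (AnyP.any⁻ _ xs p)

  ∈⇒member : ∀ {m} {xs : List (Dart m)} {d} → d ∈ xs → T (member xs d)
  ∈⇒member {d = d} p = AnyP.any⁺ _ (Any.map (λ { refl → ≡⇒T (==ᵈ-refl d) }) p)

  ∑ˡ-member : ∀ {m} {xs : List (Dart m)} → Unique xs → (h : Dart m → C) →
              ∑ˡ xs h ≡ ∑ᵈ (λ d → mask (member xs d) (h d))
  ∑ˡ-member {m} {xs = []} _ h = sym (sum-zero {m} λ _ → identityʳ 0#)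
  ∑ˡ-member {xs = y ∷ ys} (y∉ ∷ uniq) h = begin
    h y ⊹ ∑ˡ ys h
      ≡⟨ cong₂ _⊹_ (sym (∑ᵈ-single y h)) (∑ˡ-member uniq h) ⟩
    ∑ᵈ (λ d → mask (y ==ᵈ d) (h d)) ⊹ ∑ᵈ (λ d → mask (member ys d) (h d))
      ≡⟨ ∑ᵈ-distrib (λ d → mask (y ==ᵈ d) (h d)) (λ d → mask (member ys d) (h d)) ⟨
    ∑ᵈ (λ d → mask (y ==ᵈ d) (h d) ⊹ mask (member ys d) (h d))
      ≡⟨ ∑ᵈ-cong split ⟩
    ∑ᵈ (λ d → mask (member (y ∷ ys) d) (h d)) ∎
    where
    split : ∀ d → mask (y ==ᵈ d) (h d) ⊹ mask (member ys d) (h d) ≡ mask (member (y ∷ ys) d) (h d)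
    split d with y ==ᵈ d in eq
    ... | false = identityˡ _
    ... | true with member ys d in eq'
    ...   | false = identityʳ _
    ...   | true  = contradiction (==ᵈ⇒≡ (≡⇒T eq)) (All.lookup y∉ (member⇒∈ (≡⇒T eq')))

  module _ {n m} (G : EmbeddedGraph n m) where
    open EmbeddedGraph G

    member-rot : ∀ v d → member (rot v) d ≡ (endOf ends d ==ᶠ v)
    member-rot v d = iff⇒≡
      (λ p → ≡⇒==ᶠ (Equivalence.to (rot-complete v d) (member⇒∈ p)))
      (λ p → ∈⇒member (Equivalence.from (rot-complete v d) (==ᶠ⇒≡ p)))

    ∑-rot : ∀ v (h : Dart m → C) → ∑ˡ (rot v) h ≡ ∑ᵈ (λ d → mask (endOf ends d ==ᶠ v) (h d))
    ∑-rot v h = trans (∑ˡ-member (rot-unique v) h)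
                      (∑ᵈ-cong λ d → cong (λ b → mask b (h d)) (member-rot v d))

    -- Double counting: `rot-complete` and `rot-unique` put every dart into exactly one rotation,
    -- the one at its end, and exactly once.
    ∑ᵈ-by-vertex : ∀ (h : Dart m → C) → sum (λ v → ∑ˡ (rot v) h) ≡ ∑ᵈ h
    ∑ᵈ-by-vertex h = begin
      sum (λ v → ∑ˡ (rot v) h)
        ≡⟨ sum-cong (λ v → ∑-rot v h) ⟩
      sum (λ v → sum λ e → at v (e , false) ⊹ at v (e , true))
        ≡⟨ ∑-comm (λ v e → at v (e , false) ⊹ at v (e , true)) ⟩
      sum (λ e → sum λ v → at v (e , false) ⊹ at v (e , true))
        ≡⟨ sum-cong (λ e → ∑-distrib-+ (λ v → at v (e , false)) (λ v → at v (e , true))) ⟩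
      sum (λ e → sum (λ v → at v (e , false)) ⊹ sum (λ v → at v (e , true)))
        ≡⟨ sum-cong (λ e → cong₂ _⊹_ (sum-single (endOf ends (e , false)) (λ _ → h (e , false)))
                                     (sum-single (endOf ends (e , true)) (λ _ → h (e , true)))) ⟩
      ∑ᵈ h ∎
      where
      at : Fin n → Dart m → C
      at v d = mask (endOf ends d ==ᶠ v) (h d)

-- Linear algebra over 𝔽₂

open CommutativeRing xor-∧-commutativeRing using (semiring; +-isCommutativeMonoid)
open DartSum +-isCommutativeMonoid public
-- That the form is alternating is shown by halving vertex degrees, which is impossible modulo 2;
-- hence the same sums in `ℕ`.
module ℕSum = DartSum ℕP.+-0-isCommutativeMonoid
open import Algebra.Properties.Semiring.Sum semiring public using (*-distribˡ-sum; *-distribʳ-sum)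

mask≡∧ : ∀ b c → mask b c ≡ b ∧ c
mask≡∧ false c = refl
mask≡∧ true  c = refl

sum-δ : ∀ {n} (u : Fin n) (h : Fin n → Bool) → sum (λ v → (u ==ᶠ v) ∧ h v) ≡ h u
sum-δ u h = trans (sum-cong λ v → sym (mask≡∧ (u ==ᶠ v) (h v))) (sum-single u h)

sum-xor : ∀ {n} (f g : Fin n → Bool) → sum (λ i → f i xor g i) ≡ sum f xor sum g
sum-xor = ∑-distrib-+

∧-xor : ∀ a b c → a ∧ (b xor c) ≡ (a ∧ b) xor (a ∧ c)
∧-xor false b c = refl
∧-xor true  b c = refl

xor-∧ : ∀ a b c → (a xor b) ∧ c ≡ (a ∧ c) xor (b ∧ c)
xor-∧ false b c = refl
xor-∧ true false c = sym (xor-identityʳ c)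
xor-∧ true true c = sym (xor-same c)

_⊕_ : ∀ {A : Set} → (A → Bool) → (A → Bool) → A → Bool
(x ⊕ y) a = x a xor y a

-- Vectors are functions, and pointwise equal functions need not be identical, so respect for
-- pointwise equality is a field. With only two scalars, homogeneity follows from additivity.
record Linear {A : Set} (f : (A → Bool) → Bool) : Set where
  field
    resp : ∀ {x y} → x ≗ y → f x ≡ f y
    add  : ∀ x y → f (x ⊕ y) ≡ f x xor f y

  null : ∀ {x} → (∀ a → x a ≡ false) → f x ≡ false
  null {x} x≡0 = begin
    f x         ≡⟨ resp (λ a → sym (trans (cong (_xor x a) (x≡0 a)) refl)) ⟩
    f (x ⊕ x)   ≡⟨ add x x ⟩
    f x xor f x ≡⟨ xor-same (f x) ⟩
    false       ∎

  scale : ∀ c x → f (λ a → c ∧ x a) ≡ c ∧ f x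
  scale false x = null (λ _ → refl)
  scale true  x = refl

  combination : ∀ {r} (c : Fin r → Bool) (z : Fin r → A → Bool) →
                f (λ a → sum λ l → c l ∧ z l a) ≡ sum (λ l → c l ∧ f (z l))
  combination {zero}  c z = null (λ _ → refl)
  combination {suc r} c z = trans
    (add (λ a → c zero ∧ z zero a) (λ a → sum λ l → c (suc l) ∧ z (suc l) a))
    (cong₂ _xor_ (scale (c zero) (z zero)) (combination (c ∘ suc) (z ∘ suc)))

open Linear public

module _ {A : Set} where

  linear-at : (a : A) → Linear (λ x → x a)
  linear-at a = record { resp = λ eq → eq a ; add = λ _ _ → refl }

  linear-false : Linear {A} (λ _ → false)
  linear-false = record { resp = λ _ → refl ; add = λ _ _ → refl }

  linear-xor : {f g : (A → Bool) → Bool} → Linear f → Linear g → Linear (λ x → f x xor g x)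
  linear-xor {f} {g} F G = record
    { resp = λ eq → cong₂ _xor_ (resp F eq) (resp G eq)
    ; add  = λ x y → trans (cong₂ _xor_ (add F x y) (add G x y))
                           (interchange (f x) (f y) (g x) (g y)) }

  linear-∧ : {f : (A → Bool) → Bool} (c : Bool) → Linear f → Linear (λ x → c ∧ f x)
  linear-∧ {f} c F = record
    { resp = λ eq → cong (c ∧_) (resp F eq)
    ; add  = λ x y → trans (cong (c ∧_) (add F x y)) (∧-xor c (f x) (f y)) }

  linear-sum : ∀ {n} {f : Fin n → (A → Bool) → Bool} → (∀ i → Linear (f i)) →
               Linear (λ x → sum λ i → f i x)
  linear-sum {f = f} F = record
    { resp = λ eq → sum-cong λ i → resp (F i) eq
    ; add  = λ x y → trans (sum-cong λ i → add (F i) x y) (sum-xor (λ i → f i x) (λ i → f i y)) }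

  linear-∘ : {B : Set} {f : (A → Bool) → Bool} (g : A → B) → Linear f → Linear (λ x → f (x ∘ g))
  linear-∘ g F = record { resp = λ eq → resp F (eq ∘ g) ; add = λ x y → add F (x ∘ g) (y ∘ g) }

⟨_,_⟩ : ∀ {n} → (Fin n → Bool) → (Fin n → Bool) → Bool
⟨ x , y ⟩ = sum λ i → x i ∧ y i

⟨,⟩-comm : ∀ {n} (x y : Fin n → Bool) → ⟨ x , y ⟩ ≡ ⟨ y , x ⟩
⟨,⟩-comm x y = sum-cong λ i → ∧-comm (x i) (y i)

⟨,⟩-linearʳ : ∀ {n} (x : Fin n → Bool) → Linear (λ y → ⟨ x , y ⟩)
⟨,⟩-linearʳ x = linear-sum λ i → linear-∧ (x i) (linear-at i)

⟨,⟩-linearˡ : ∀ {n} (y : Fin n → Bool) → Linear (λ x → ⟨ x , y ⟩)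
⟨,⟩-linearˡ y = record
  { resp = λ eq → sum-cong λ i → cong (_∧ y i) (eq i)
  ; add  = λ x x' → trans (⟨,⟩-comm (x ⊕ x') y)
             (trans (add (⟨,⟩-linearʳ y) x x') (cong₂ _xor_ (⟨,⟩-comm y x) (⟨,⟩-comm y x'))) }

-- Counting via injections between 𝔽₂-vector spaces

module _ {A : Set} (_≟_ : DecidableEquality A) where

  extend : (xs : List A) → (Fin (length xs) → Bool) → A → Bool
  extend []       w a = false
  extend (x ∷ xs) w a = if does (a ≟ x) then w zero else extend xs (w ∘ suc) a

  extend-lookup : ∀ {xs} → Unique xs → ∀ w i → extend xs w (lookup xs i) ≡ w i
  extend-lookup {x ∷ xs} _ w zero with x ≟ x
  ... | yes _ = refl
  ... | no ¬p = contradiction refl ¬p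
  extend-lookup {x ∷ xs} (x∉ ∷ uniq) w (suc i) with lookup xs i ≟ x
  ... | yes eq = contradiction (sym eq) (All.lookup x∉ (∈-lookup i))
  ... | no  _  = extend-lookup uniq (w ∘ suc) i

bit : Bool → Fin 2
bit false = zero
bit true  = suc zero

unbit : Fin 2 → Bool
unbit zero       = false
unbit (suc zero) = true

unbit-bit : ∀ b → unbit (bit b) ≡ b
unbit-bit false = refl
unbit-bit true  = refl

bit-unbit : ∀ i → bit (unbit i) ≡ i
bit-unbit zero       = refl
bit-unbit (suc zero) = refl

2^-cancel-≤ : ∀ {a b} → 2 ^ a ≤ 2 ^ b → a ≤ b
2^-cancel-≤ {a} {b} le with a ℕ.≤? b
... | yes p = p
... | no ¬p = contradiction le (ℕP.<⇒≱ (ℕP.^-monoʳ-< 2 (s≤s (s≤s z≤n)) (ℕP.≰⇒> ¬p)))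

-- Substitute for dimension: the `2 ^ length xs` functions on `xs` are told apart by the values of
-- their images on `ys`. `Φ` is an arbitrary map so that it may involve coefficients taken from an
-- existence statement, as in `spanning⇒≤`.
injection⇒≤ : {A B : Set} → DecidableEquality A → {xs : List A} {ys : List B} → Unique xs →
  (Φ : (A → Bool) → B → Bool) →
  (∀ u u' → (∀ {b} → b ∈ ys → Φ u b ≡ Φ u' b) → ∀ {a} → a ∈ xs → u a ≡ u' a) →
  length xs ≤ length ys
injection⇒≤ {A} {B} _≟_ {xs} {ys} uniq Φ inj = 2^-cancel-≤ (FinP.injective⇒≤ code-injective)
  where
  fun : Fin (2 ^ length xs) → A → Bool
  fun c = extend _≟_ xs (unbit ∘ Fin.finToFun c)

  values : Fin (2 ^ length xs) → Fin (length ys) → Fin 2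
  values c j = bit (Φ (fun c) (lookup ys j))

  code : Fin (2 ^ length xs) → Fin (2 ^ length ys)
  code c = Fin.funToFin (values c)

  bit-injective : ∀ {a b} → bit a ≡ bit b → a ≡ b
  bit-injective {a} {b} eq = trans (sym (unbit-bit a)) (trans (cong unbit eq) (unbit-bit b))

  unbit-injective : ∀ {i j} → unbit i ≡ unbit j → i ≡ j
  unbit-injective {i} {j} eq = trans (sym (bit-unbit i)) (trans (cong bit eq) (bit-unbit j))

  funToFin-cong : ∀ {k l} {f g : Fin k → Fin l} → f ≗ g → Fin.funToFin f ≡ Fin.funToFin g
  funToFin-cong {zero}  eq = refl
  funToFin-cong {suc k} eq = cong₂ Fin.combine (eq zero) (funToFin-cong (eq ∘ suc))

  code-injective : ∀ {c c'} → code c ≡ code c' → c ≡ c'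
  code-injective {c} {c'} eq = begin
    c                             ≡⟨ FinP.funToFin-finToFin {length xs} c ⟨
    Fin.funToFin {length xs} (Fin.finToFun c)  ≡⟨ funToFin-cong digits ⟩
    Fin.funToFin {length xs} (Fin.finToFun c') ≡⟨ FinP.funToFin-finToFin {length xs} c' ⟩
    c'                            ∎
    where
    same : ∀ {b} → b ∈ ys → Φ (fun c) b ≡ Φ (fun c') b
    same b∈ = subst (λ b → Φ (fun c) b ≡ Φ (fun c') b) (sym (AnyP.lookup-index b∈))
      (bit-injective (begin
        values c  (Any.index b∈) ≡⟨ FinP.finToFun-funToFin (values c) (Any.index b∈) ⟨
        Fin.finToFun (code c) (Any.index b∈)  ≡⟨ cong (λ k → Fin.finToFun k (Any.index b∈)) eq ⟩
        Fin.finToFun (code c') (Any.index b∈) ≡⟨ FinP.finToFun-funToFin (values c') (Any.index b∈) ⟩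
        values c' (Any.index b∈) ∎))
    digits : Fin.finToFun c ≗ Fin.finToFun c'
    digits i = unbit-injective (begin
      unbit (Fin.finToFun c i)  ≡⟨ extend-lookup _≟_ uniq _ i ⟨
      fun c (lookup xs i)       ≡⟨ inj (fun c) (fun c') same (∈-lookup i) ⟩
      fun c' (lookup xs i)      ≡⟨ extend-lookup _≟_ uniq _ i ⟩
      unbit (Fin.finToFun c' i) ∎)

linear-injection⇒≤ : {A B : Set} → DecidableEquality A → {xs : List A} {ys : List B} → Unique xs →
  (Φ : (A → Bool) → B → Bool) → (∀ b → Linear (λ u → Φ u b)) →
  (∀ u → (∀ {b} → b ∈ ys → Φ u b ≡ false) → ∀ {a} → a ∈ xs → u a ≡ false) →
  length xs ≤ length ys
linear-injection⇒≤ _≟_ uniq Φ lin ker = injection⇒≤ _≟_ uniq Φ λ u u' eq a∈ →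
  xor≡false⇒≡ (ker (u ⊕ u') (λ {b} b∈ → trans (add (lin b) u u') (≡⇒xor≡false (eq b∈))) a∈)

_⊞_ : {A B : Set} → List A → List B → List (A ⊎ B)
xs ⊞ ys = map inj₁ xs ++ map inj₂ ys

⊞-unique : {A B : Set} {xs : List A} {ys : List B} → Unique xs → Unique ys → Unique (xs ⊞ ys)
⊞-unique ux uy = UniqueP.++⁺ (UniqueP.map⁺ (λ { refl → refl }) ux) (UniqueP.map⁺ (λ { refl → refl }) uy)
  λ (p , q) → disjoint (∈-map⁻ inj₁ p) (∈-map⁻ inj₂ q)
  where
  disjoint : ∀ {A B : Set} {P : A → Set} {Q : B → Set} {z : A ⊎ B} →
             ∃ (λ x → P x × z ≡ inj₁ x) → ∃ (λ y → Q y × z ≡ inj₂ y) → ⊥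
  disjoint (_ , _ , refl) (_ , _ , ())

length-⊞ : {A B : Set} (xs : List A) (ys : List B) → length (xs ⊞ ys) ≡ length xs + length ys
length-⊞ xs ys = trans (ListP.length-++ (map inj₁ xs))
                       (cong₂ _+_ (ListP.length-map inj₁ xs) (ListP.length-map inj₂ ys))

∈-⊞ˡ : {A B : Set} {xs : List A} {ys : List B} {x : A} → x ∈ xs → inj₁ x ∈ xs ⊞ ys
∈-⊞ˡ p = ∈-++⁺ˡ (∈-map⁺ inj₁ p)

∈-⊞ʳ : {A B : Set} {xs : List A} {ys : List B} {y : B} → y ∈ ys → inj₂ y ∈ xs ⊞ ys
∈-⊞ʳ {xs = xs} p = ∈-++⁺ʳ (map inj₁ xs) (∈-map⁺ inj₂ p)

-- Rotations

data Adjacent {A : Set} : List A → A → A → Set where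
  here  : ∀ {x y zs} → Adjacent (x ∷ y ∷ zs) x y
  there : ∀ {z zs x y} → Adjacent zs x y → Adjacent (z ∷ zs) x y

data Last {A : Set} : List A → A → Set where
  here  : ∀ {x} → Last (x ∷ []) x
  there : ∀ {y z zs x} → Last (z ∷ zs) x → Last (y ∷ z ∷ zs) x

module _ {A : Set} where

  Adjacent⇒∈ˡ : ∀ {xs} {x y : A} → Adjacent xs x y → x ∈ xs
  Adjacent⇒∈ˡ here      = here refl
  Adjacent⇒∈ˡ (there p) = there (Adjacent⇒∈ˡ p)

  Adjacent⇒∈ʳ : ∀ {z zs} {x y : A} → Adjacent (z ∷ zs) x y → y ∈ zs
  Adjacent⇒∈ʳ {zs = _ ∷ _} here      = here refl
  Adjacent⇒∈ʳ {zs = _ ∷ _} (there p) = there (Adjacent⇒∈ʳ p)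

  Last⇒∈ : ∀ {xs} {x : A} → Last xs x → x ∈ xs
  Last⇒∈ here      = here refl
  Last⇒∈ (there p) = there (Last⇒∈ p)

  Last-unique : ∀ {xs} {x y : A} → Last xs x → Last xs y → x ≡ y
  Last-unique here      here      = refl
  Last-unique (there p) (there q) = Last-unique p q

  last-exists : ∀ (x : A) xs → ∃ (Last (x ∷ xs))
  last-exists x []       = x , here
  last-exists x (y ∷ ys) = _ , there (proj₂ (last-exists y ys))

  Adjacent-injective : ∀ {xs} {x x' y : A} → Unique xs → Adjacent xs x y → Adjacent xs x' y → x ≡ x'
  Adjacent-injective u             here      here      = refl
  Adjacent-injective (_ ∷ y∉ ∷ _)  here      (there q) = contradiction refl (All.lookup y∉ (Adjacent⇒∈ʳ q))
  Adjacent-injective (_ ∷ y∉ ∷ _)  (there p) here      = contradiction refl (All.lookup y∉ (Adjacent⇒∈ʳ p))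
  Adjacent-injective (_ ∷ u)       (there p) (there q) = Adjacent-injective u p q

  Adjacent-functional : ∀ {xs} {x y y' : A} → Unique xs → Adjacent xs x y → Adjacent xs x y' → y ≡ y'
  Adjacent-functional u        here      here      = refl
  Adjacent-functional (x∉ ∷ _) here      (there q) = contradiction refl (All.lookup x∉ (Adjacent⇒∈ˡ q))
  Adjacent-functional (x∉ ∷ _) (there p) here      = contradiction refl (All.lookup x∉ (Adjacent⇒∈ˡ p))
  Adjacent-functional (_ ∷ u)  (there p) (there q) = Adjacent-functional u p q

  Last⇒¬Adjacent : ∀ {xs} {x y : A} → Unique xs → Last xs x → ¬ Adjacent xs x y
  Last⇒¬Adjacent (x∉ ∷ _) (there p) here      = All.lookup x∉ (Last⇒∈ p) refl
  Last⇒¬Adjacent (_ ∷ u)  (there p) (there q) = Last⇒¬Adjacent u p q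
  Last⇒¬Adjacent _        here      (there ())

-- The metavariable is solved by the type of next-unfold: it names the local function of next.
mutual
  nextFrom : ∀ {m} → Dart m → List (Dart m) → Dart m → Dart m → List (Dart m) → Dart m
  nextFrom = _

  next-unfold : ∀ {m} (x₀ d y : Dart m) ys → (x₀ ==ᵈ d) ≡ false →
                next (x₀ ∷ y ∷ ys) d ≡ nextFrom x₀ (y ∷ ys) d y ys
  next-unfold x₀ d y ys eq with y ∷ ys
  ... | zs rewrite eq = refl

module _ {m : ℕ} where

  nextFrom-cases : ∀ (x₀ : Dart m) zs {d} x ys → d ∈ x ∷ ys →
    (Last (x ∷ ys) d × nextFrom x₀ zs d x ys ≡ x₀) ⊎ Adjacent (x ∷ ys) d (nextFrom x₀ zs d x ys)
  nextFrom-cases x₀ zs {d} x [] (here refl) rewrite ==ᵈ-refl d = inj₁ (here , refl)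
  nextFrom-cases x₀ zs {d} x (y ∷ ys) d∈ with x ==ᵈ d in eq
  ... | true = inj₂ (subst (λ z → Adjacent (x ∷ y ∷ ys) z y) (==ᵈ⇒≡ (≡⇒T eq)) here)
  ... | false with d∈
  ...   | here refl = contradiction (trans (sym (==ᵈ-refl d)) eq) λ ()
  ...   | there d∈ys with nextFrom-cases x₀ zs y ys d∈ys
  ...     | inj₁ (l , eq') = inj₁ (there l , eq')
  ...     | inj₂ a         = inj₂ (there a)

  next-cases : ∀ (x₀ : Dart m) xs {d} → d ∈ x₀ ∷ xs →
    (Last (x₀ ∷ xs) d × next (x₀ ∷ xs) d ≡ x₀) ⊎ Adjacent (x₀ ∷ xs) d (next (x₀ ∷ xs) d)
  next-cases x₀ xs = nextFrom-cases x₀ xs x₀ xs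

  next-∈ : ∀ {xs} {d : Dart m} → d ∈ xs → next xs d ∈ xs
  next-∈ {x₀ ∷ xs} d∈ with next-cases x₀ xs d∈
  ... | inj₁ (_ , eq) = here eq
  ... | inj₂ a        = there (Adjacent⇒∈ʳ a)

  next-injective : ∀ {xs} {d d' : Dart m} → Unique xs → d ∈ xs → d' ∈ xs → next xs d ≡ next xs d' → d ≡ d'
  next-injective {x₀ ∷ xs} {d} {d'} u@(x₀∉ ∷ _) d∈ d'∈ eq with next-cases x₀ xs d∈ | next-cases x₀ xs d'∈
  ... | inj₁ (l , _)  | inj₁ (l' , _)  = Last-unique l l'
  ... | inj₂ a        | inj₂ a'        = Adjacent-injective u (subst (Adjacent _ d) eq a) a'
  ... | inj₁ (_ , e₀) | inj₂ a'        = contradiction (trans (sym e₀) eq) (All.lookup x₀∉ (Adjacent⇒∈ʳ a'))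
  ... | inj₂ a        | inj₁ (_ , e₀)  = contradiction (trans (sym e₀) (sym eq)) (All.lookup x₀∉ (Adjacent⇒∈ʳ a))

  next-Adjacent : ∀ {xs} {d r : Dart m} → Unique xs → Adjacent xs d r → next xs d ≡ r
  next-Adjacent {x₀ ∷ xs} u a with next-cases x₀ xs (Adjacent⇒∈ˡ a)
  ... | inj₁ (l , _) = contradiction a (Last⇒¬Adjacent u l)
  ... | inj₂ a'      = Adjacent-functional u a' a

  next-Last : ∀ {x₀ xs} {d : Dart m} → Unique (x₀ ∷ xs) → Last (x₀ ∷ xs) d → next (x₀ ∷ xs) d ≡ x₀
  next-Last {x₀} {xs} u l with next-cases x₀ xs (Last⇒∈ l)
  ... | inj₁ (_ , eq) = eq
  ... | inj₂ a        = contradiction a (Last⇒¬Adjacent u l)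

  -- Parity of the `h`-darts preceding `d` once the cyclic order is cut open at the head of the
  -- list. If `h` has even total, another cut changes all these values by one common constant.
  before : List (Dart m) → (Dart m → Bool) → Dart m → Bool
  before []       h d = false
  before (y ∷ ys) h d = if y ==ᵈ d then false else h y xor before ys h d

  before-head : ∀ y ys h → before (y ∷ ys) h y ≡ false
  before-head y ys h rewrite ==ᵈ-refl y = refl

  before-tail : ∀ {y ys} → Unique (y ∷ ys) → ∀ h {d} → d ∈ ys → before (y ∷ ys) h d ≡ h y xor before ys h d
  before-tail (y∉ ∷ _) h d∈ rewrite ≢⇒==ᵈ (All.lookup y∉ d∈) = refl

  before-linear : ∀ xs d → Linear (λ h → before xs h d)
  before-linear [] d = linear-false
  before-linear (y ∷ ys) d with y ==ᵈ d
  ... | true  = linear-false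
  ... | false = linear-xor (linear-at y) (before-linear ys d)

  before-Adjacent : ∀ {xs} {d r} → Unique xs → Adjacent xs d r → ∀ h → before xs h r ≡ before xs h d xor h d
  before-Adjacent {x ∷ y ∷ zs} u here h = begin
    before (x ∷ y ∷ zs) h y           ≡⟨ before-tail u h (here refl) ⟩
    h x xor before (y ∷ zs) h y       ≡⟨ cong (h x xor_) (before-head y zs h) ⟩
    h x xor false                     ≡⟨ xor-identityʳ (h x) ⟩
    h x                               ≡⟨ cong (_xor h x) (before-head x (y ∷ zs) h) ⟨
    before (x ∷ y ∷ zs) h x xor h x   ∎
  before-Adjacent {z ∷ zs} {d} {r} u@(_ ∷ u') (there a) h = begin
    before (z ∷ zs) h r               ≡⟨ before-tail u h (tail∈ a) ⟩
    h z xor before zs h r             ≡⟨ cong (h z xor_) (before-Adjacent u' a h) ⟩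
    h z xor (before zs h d xor h d)   ≡⟨ xor-assoc (h z) _ _ ⟨
    (h z xor before zs h d) xor h d   ≡⟨ cong (_xor h d) (before-tail u h (Adjacent⇒∈ˡ a)) ⟨
    before (z ∷ zs) h d xor h d       ∎
    where
    tail∈ : ∀ {ys} {x y : Dart m} → Adjacent ys x y → y ∈ ys
    tail∈ {_ ∷ _} a = there (Adjacent⇒∈ʳ a)

  before-Last : ∀ {xs} {d} → Unique xs → Last xs d → ∀ h → before xs h d xor h d ≡ ∑ˡ xs h
  before-Last {x ∷ []} u here h = begin
    before (x ∷ []) h x xor h x ≡⟨ cong (_xor h x) (before-head x [] h) ⟩
    h x                         ≡⟨ xor-identityʳ (h x) ⟨
    h x xor false               ∎
  before-Last {y ∷ ys} {d} u@(_ ∷ u') (there l) h = begin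
    before (y ∷ ys) h d xor h d     ≡⟨ cong (_xor h d) (before-tail u h (Last⇒∈ l)) ⟩
    (h y xor before ys h d) xor h d ≡⟨ xor-assoc (h y) _ _ ⟩
    h y xor (before ys h d xor h d) ≡⟨ cong (h y xor_) (before-Last u' l h) ⟩
    h y xor ∑ˡ ys h                 ∎

  -- Inside the list this is one more predecessor. At the wrap from the last dart to the first, the
  -- vanishing total accounts for the count starting again at `false`.
  before-next : ∀ {xs} → Unique xs → ∀ h → ∑ˡ xs h ≡ false → ∀ {d} → d ∈ xs →
                before xs h (next xs d) ≡ before xs h d xor h d
  before-next {x₀ ∷ xs} u h ∑≡0 {d} d∈ with next-cases x₀ xs d∈
  ... | inj₂ a        = before-Adjacent u a h
  ... | inj₁ (l , eq) = begin
    before (x₀ ∷ xs) h (next (x₀ ∷ xs) d) ≡⟨ cong (before (x₀ ∷ xs) h) eq ⟩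
    before (x₀ ∷ xs) h x₀                 ≡⟨ before-head x₀ xs h ⟩
    false                                 ≡⟨ ∑≡0 ⟨
    ∑ˡ (x₀ ∷ xs) h                        ≡⟨ before-Last u l h ⟨
    before (x₀ ∷ xs) h d xor h d          ∎

  increments-Adjacent : ∀ {x₀ xs} → Unique (x₀ ∷ xs) → ∀ (f h : Dart m → Bool) →
    (∀ {d r} → Adjacent (x₀ ∷ xs) d r → f r ≡ f d xor h d) →
    ∀ {d} → d ∈ x₀ ∷ xs → f d ≡ f x₀ xor before (x₀ ∷ xs) h d
  increments-Adjacent {x₀} {xs} u f h step (here refl) = begin
    f x₀                             ≡⟨ xor-identityʳ (f x₀) ⟨
    f x₀ xor false                   ≡⟨ cong (f x₀ xor_) (before-head x₀ xs h) ⟨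
    f x₀ xor before (x₀ ∷ xs) h x₀   ∎
  increments-Adjacent {x₀} {y ∷ ys} u@(_ ∷ u') f h step {d} (there d∈) = begin
    f d                                    ≡⟨ increments-Adjacent u' f h (step ∘ there) d∈ ⟩
    f y xor before (y ∷ ys) h d            ≡⟨ cong (_xor before (y ∷ ys) h d) (step here) ⟩
    (f x₀ xor h x₀) xor before (y ∷ ys) h d ≡⟨ xor-assoc (f x₀) _ _ ⟩
    f x₀ xor (h x₀ xor before (y ∷ ys) h d) ≡⟨ cong (f x₀ xor_) (before-tail u h d∈) ⟨
    f x₀ xor before (x₀ ∷ y ∷ ys) h d      ∎

  module _ {x₀ xs} (u : Unique (x₀ ∷ xs)) (f h : Dart m → Bool)
           (step : ∀ {d} → d ∈ x₀ ∷ xs → f (next (x₀ ∷ xs) d) ≡ f d xor h d) where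

    increments : ∀ {d} → d ∈ x₀ ∷ xs → f d ≡ f x₀ xor before (x₀ ∷ xs) h d
    increments = increments-Adjacent u f h λ a →
      trans (cong f (sym (next-Adjacent u a))) (step (Adjacent⇒∈ˡ a))

    -- Once round the rotation `f` is back at its initial value, so its increments cancel.
    increments-sum : ∑ˡ (x₀ ∷ xs) h ≡ false
    increments-sum with last-exists x₀ xs
    ... | d , l = begin
      ∑ˡ (x₀ ∷ xs) h                   ≡⟨ before-Last u l h ⟨
      before (x₀ ∷ xs) h d xor h d     ≡⟨ cancel (f x₀) _ _ ⟨
      f x₀ xor ((f x₀ xor before (x₀ ∷ xs) h d) xor h d)
        ≡⟨ cong (λ b → f x₀ xor (b xor h d)) (increments (Last⇒∈ l)) ⟨
      f x₀ xor (f d xor h d)           ≡⟨ cong (f x₀ xor_) (step (Last⇒∈ l)) ⟨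
      f x₀ xor f (next (x₀ ∷ xs) d)    ≡⟨ cong (λ r → f x₀ xor f r) (next-Last u l) ⟩
      f x₀ xor f x₀                    ≡⟨ xor-same (f x₀) ⟩
      false                            ∎
      where
      cancel : ∀ a b c → a xor ((a xor b) xor c) ≡ b xor c
      cancel = solve 3 (λ a b c → a :+ ((a :+ b) :+ c) := b :+ c) refl
        where open xor-∧-Solver

  ∑ˡ-filter : ∀ p xs (h : Dart m → Bool) → (∀ d → p d ≡ false → h d ≡ false) →
              ∑ˡ (filterᵇ p xs) h ≡ ∑ˡ xs h
  ∑ˡ-filter p [] h supp = refl
  ∑ˡ-filter p (x ∷ xs) h supp with p x in eq
  ... | true  = cong (h x xor_) (∑ˡ-filter p xs h supp)
  ... | false rewrite supp x eq = ∑ˡ-filter p xs h supp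

  -- Deleted darts carry no weight. Hence the potential of a chain supported in a subgraph can be
  -- read off from the full rotation, and one form serves all subfamilies.
  before-filter : ∀ p xs (h : Dart m → Bool) → (∀ d → p d ≡ false → h d ≡ false) →
                  ∀ {d} → p d ≡ true → before (filterᵇ p xs) h d ≡ before xs h d
  before-filter p [] h supp pd = refl
  before-filter p (x ∷ xs) h supp {d} pd with p x in eq
  ... | true with x ==ᵈ d
  ...   | true  = refl
  ...   | false = cong (h x xor_) (before-filter p xs h supp pd)
  before-filter p (x ∷ xs) h supp {d} pd | false with x ==ᵈ d in eq'
  ...   | true  = contradiction (trans (sym eq) (trans (cong p (==ᵈ⇒≡ (≡⇒T eq'))) pd)) λ ()
  ...   | false rewrite supp x eq = before-filter p xs h supp pd

  ∧-∑ˡ : ∀ c xs (h : Dart m → Bool) → ∑ˡ xs (λ d → c ∧ h d) ≡ c ∧ ∑ˡ xs h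
  ∧-∑ˡ c []       h = sym (∧-zeroʳ c)
  ∧-∑ˡ c (x ∷ xs) h = trans (cong ((c ∧ h x) xor_) (∧-∑ˡ c xs h)) (sym (∧-xor c (h x) (∑ˡ xs h)))

  ∑ˡ-xor : ∀ (xs : List (Dart m)) h h' → ∑ˡ xs (λ d → h d xor h' d) ≡ ∑ˡ xs h xor ∑ˡ xs h'
  ∑ˡ-xor []       h h' = refl
  ∑ˡ-xor (x ∷ xs) h h' = trans (cong ((h x xor h' x) xor_) (∑ˡ-xor xs h h')) (interchange (h x) _ _ _)

  ∑ˡ-before-cons : ∀ {y ys} → Unique (y ∷ ys) → ∀ x z →
    ∑ˡ (y ∷ ys) (λ d → z d ∧ before (y ∷ ys) x d) ≡ (x y ∧ ∑ˡ ys z) xor ∑ˡ ys (λ d → z d ∧ before ys x d)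
  ∑ˡ-before-cons {y} {ys} u x z = begin
    (z y ∧ before (y ∷ ys) x y) xor ∑ˡ ys (λ d → z d ∧ before (y ∷ ys) x d)
      ≡⟨ cong₂ _xor_ (trans (cong (z y ∧_) (before-head y ys x)) (∧-zeroʳ (z y)))
                     (∑ˡ-cong ys λ {d} d∈ → trans (cong (z d ∧_) (before-tail u x d∈)) (expand (z d) (x y) (before ys x d))) ⟩
    ∑ˡ ys (λ d → (x y ∧ z d) xor (z d ∧ before ys x d))
      ≡⟨ ∑ˡ-xor ys (λ d → x y ∧ z d) (λ d → z d ∧ before ys x d) ⟩
    ∑ˡ ys (λ d → x y ∧ z d) xor ∑ˡ ys (λ d → z d ∧ before ys x d)
      ≡⟨ cong (_xor ∑ˡ ys (λ d → z d ∧ before ys x d)) (∧-∑ˡ (x y) ys z) ⟩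
    (x y ∧ ∑ˡ ys z) xor ∑ˡ ys (λ d → z d ∧ before ys x d) ∎
    where
    expand : ∀ a b c → a ∧ (b xor c) ≡ (b ∧ a) xor (a ∧ c)
    expand = solve 3 (λ a b c → a :* (b :+ c) := b :* a :+ a :* c) refl
      where open xor-∧-Solver

  -- Each ordered pair of distinct darts contributes `x` at the one times `z` at the other exactly
  -- once on the left, whichever of them comes first. The product of the two sums contains the
  -- diagonal in addition.
  before-symmetric : ∀ {xs} → Unique xs → ∀ x z →
    ∑ˡ xs (λ d → z d ∧ before xs x d) xor ∑ˡ xs (λ d → x d ∧ before xs z d)
      ≡ (∑ˡ xs x ∧ ∑ˡ xs z) xor ∑ˡ xs (λ d → x d ∧ z d)
  before-symmetric {[]} _ x z = refl
  before-symmetric {y ∷ ys} u@(_ ∷ u') x z = begin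
    ∑ˡ (y ∷ ys) (λ d → z d ∧ before (y ∷ ys) x d) xor ∑ˡ (y ∷ ys) (λ d → x d ∧ before (y ∷ ys) z d)
      ≡⟨ cong₂ _xor_ (∑ˡ-before-cons u x z) (∑ˡ-before-cons u z x) ⟩
    ((x y ∧ Z) xor P) xor ((z y ∧ X) xor Q)
      ≡⟨ regroup (x y) Z P (z y) X Q ⟩
    ((x y ∧ Z) xor (z y ∧ X)) xor (P xor Q)
      ≡⟨ cong (((x y ∧ Z) xor (z y ∧ X)) xor_) (before-symmetric u' x z) ⟩
    ((x y ∧ Z) xor (z y ∧ X)) xor ((X ∧ Z) xor XZ)
      ≡⟨ expand (x y) X (z y) Z XZ ⟩
    ((x y xor X) ∧ (z y xor Z)) xor ((x y ∧ z y) xor XZ) ∎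
    where
    open xor-∧-Solver
    X  = ∑ˡ ys x
    Z  = ∑ˡ ys z
    P  = ∑ˡ ys (λ d → z d ∧ before ys x d)
    Q  = ∑ˡ ys (λ d → x d ∧ before ys z d)
    XZ = ∑ˡ ys (λ d → x d ∧ z d)
    regroup : ∀ a Z P b X Q → ((a ∧ Z) xor P) xor ((b ∧ X) xor Q) ≡ ((a ∧ Z) xor (b ∧ X)) xor (P xor Q)
    regroup = solve 6 (λ a Z P b X Q → ((a :* Z) :+ P) :+ ((b :* X) :+ Q) := ((a :* Z) :+ (b :* X)) :+ (P :+ Q)) refl
    expand : ∀ a X b Z W → ((a ∧ Z) xor (b ∧ X)) xor ((X ∧ Z) xor W) ≡ ((a xor X) ∧ (b xor Z)) xor ((a ∧ b) xor W)
    expand = solve 5 (λ a X b Z W → ((a :* Z) :+ (b :* X)) :+ ((X :* Z) :+ W) := ((a :+ X) :* (b :+ Z)) :+ ((a :* b) :+ W)) refl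

toℕᵇ : Bool → ℕ
toℕᵇ false = 0
toℕᵇ true  = 1

-- Along a rotation the darts of h alternate between an even and an odd number of predecessors in h.
before-alternates : ∀ {m} {xs : List (Dart m)} → Unique xs → ∀ c h →
  2 * ℕSum.∑ˡ xs (λ d → toℕᵇ (h d ∧ (c xor before xs h d))) + toℕᵇ (c xor ∑ˡ xs h)
    ≡ ℕSum.∑ˡ xs (λ d → toℕᵇ (h d)) + toℕᵇ c
before-alternates {xs = []} _ c h = cong toℕᵇ (xor-identityʳ c)
before-alternates {xs = y ∷ ys} u@(_ ∷ u') c h = begin
  2 * (toℕᵇ (h y ∧ (c xor before (y ∷ ys) h y)) + ℕSum.∑ˡ ys (λ d → toℕᵇ (h d ∧ (c xor before (y ∷ ys) h d))))
      + toℕᵇ (c xor (h y xor ∑ˡ ys h))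
    ≡⟨ cong₂ (λ a b → 2 * a + toℕᵇ b)
         (cong₂ _+_ (cong (λ b → toℕᵇ (h y ∧ b)) (trans (cong (c xor_) (before-head y ys h)) (xor-identityʳ c)))
                    (ℕSum.∑ˡ-cong ys λ {d} d∈ → cong (λ b → toℕᵇ (h d ∧ b))
                       (trans (cong (c xor_) (before-tail u h d∈)) (sym (xor-assoc c (h y) _)))))
         (sym (xor-assoc c (h y) _)) ⟩
  2 * (toℕᵇ (h y ∧ c) + A) + toℕᵇ ((c xor h y) xor ∑ˡ ys h)
    ≡⟨ cong (_+ toℕᵇ ((c xor h y) xor ∑ˡ ys h)) (ℕP.*-distribˡ-+ 2 (toℕᵇ (h y ∧ c)) A) ⟩
  (2 * toℕᵇ (h y ∧ c) + 2 * A) + toℕᵇ ((c xor h y) xor ∑ˡ ys h)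
    ≡⟨ ℕP.+-assoc (2 * toℕᵇ (h y ∧ c)) (2 * A) _ ⟩
  2 * toℕᵇ (h y ∧ c) + (2 * A + toℕᵇ ((c xor h y) xor ∑ˡ ys h))
    ≡⟨ cong (2 * toℕᵇ (h y ∧ c) +_) (before-alternates u' (c xor h y) h) ⟩
  2 * toℕᵇ (h y ∧ c) + (N + toℕᵇ (c xor h y))
    ≡⟨ cases (h y) c ⟩
  (toℕᵇ (h y) + N) + toℕᵇ c ∎
  where
  A = ℕSum.∑ˡ ys (λ d → toℕᵇ (h d ∧ ((c xor h y) xor before ys h d)))
  N = ℕSum.∑ˡ ys (λ d → toℕᵇ (h d))
  cases : ∀ a c → 2 * toℕᵇ (a ∧ c) + (N + toℕᵇ (c xor a)) ≡ (toℕᵇ a + N) + toℕᵇ c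
  cases false false = refl
  cases false true  = refl
  cases true  false = trans (ℕP.+-comm N 1) (sym (ℕP.+-identityʳ (1 + N)))
  cases true  true  = trans (cong (λ k → 2 + k) (ℕP.+-identityʳ N)) (ℕP.+-comm 1 (1 + N))

-- Chains, cycles and the intersection form modulo 2

odd : ℕ → Bool
odd zero    = false
odd (suc k) = not (odd k)

odd-+ : ∀ a b → odd (a + b) ≡ odd a xor odd b
odd-+ zero    b = refl
odd-+ (suc a) b = trans (cong not (odd-+ a b)) (BoolP.not-distribˡ-xor (odd a) (odd b))

odd-toℕᵇ : ∀ b → odd (toℕᵇ b) ≡ b
odd-toℕᵇ false = refl
odd-toℕᵇ true  = refl

odd-sum : ∀ {n} (f : Fin n → Bool) → odd (ℕSum.sum (toℕᵇ ∘ f)) ≡ sum f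
odd-sum {zero}  f = refl
odd-sum {suc n} f = trans (odd-+ (toℕᵇ (f zero)) _) (cong₂ _xor_ (odd-toℕᵇ (f zero)) (odd-sum (f ∘ suc)))

module Homology {n m : ℕ} (G : EmbeddedGraph n m) where
  open EmbeddedGraph G

  Chain : Set
  Chain = Fin m → Bool

  src tgt : Fin m → Fin n
  src e = proj₁ (ends e)
  tgt e = proj₂ (ends e)

  end : Dart m → Fin n
  end = endOf ends

  onDarts : Chain → Dart m → Bool
  onDarts x d = x (proj₁ d)

  bd : Chain → Fin n → Bool
  bd x v = ⟨ x , (λ e → (src e ==ᶠ v) xor (tgt e ==ᶠ v)) ⟩

  Cycle : Chain → Set
  Cycle x = ∀ v → bd x v ≡ false

  bd-linear : ∀ v → Linear (λ x → bd x v)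
  bd-linear v = ⟨,⟩-linearˡ _

  ∑-rot≡bd : ∀ x v → ∑ˡ (rot v) (onDarts x) ≡ bd x v
  ∑-rot≡bd x v = trans (∑-rot G v (onDarts x))
    (sum-cong λ e → lem (src e ==ᶠ v) (tgt e ==ᶠ v) (x e))
    where
    lem : ∀ a b c → mask a c xor mask b c ≡ c ∧ (a xor b)
    lem false false c = sym (∧-zeroʳ c)
    lem false true  c = sym (∧-identityʳ c)
    lem true  false c = trans (xor-identityʳ c) (sym (∧-identityʳ c))
    lem true  true  c = trans (xor-same c) (sym (∧-zeroʳ c))

  -- Coboundary and boundary are adjoint: both sides sum `κ` over the ends of the edges of `z`. In
  -- particular coboundaries pair to zero with cycles.
  stokes : ∀ (κ : Fin n → Bool) z → ⟨ z , (λ e → κ (src e) xor κ (tgt e)) ⟩ ≡ ⟨ κ , bd z ⟩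
  stokes κ z = sym (begin
    sum (λ v → κ v ∧ bd z v)
      ≡⟨ sum-cong (λ v → *-distribˡ-sum (κ v) (λ e → z e ∧ ((src e ==ᶠ v) xor (tgt e ==ᶠ v)))) ⟩
    sum (λ v → sum λ e → κ v ∧ (z e ∧ ((src e ==ᶠ v) xor (tgt e ==ᶠ v))))
      ≡⟨ ∑-comm (λ v e → κ v ∧ (z e ∧ ((src e ==ᶠ v) xor (tgt e ==ᶠ v)))) ⟩
    sum (λ e → sum λ v → κ v ∧ (z e ∧ ((src e ==ᶠ v) xor (tgt e ==ᶠ v))))
      ≡⟨ sum-cong (λ e → trans (sum-cong λ v → expand (κ v) (z e) (src e ==ᶠ v) (tgt e ==ᶠ v))
                        (trans (sum-xor (λ v → (src e ==ᶠ v) ∧ (z e ∧ κ v)) (λ v → (tgt e ==ᶠ v) ∧ (z e ∧ κ v)))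
                        (trans (cong₂ _xor_ (sum-δ (src e) (λ v → z e ∧ κ v)) (sum-δ (tgt e) (λ v → z e ∧ κ v)))
                               (sym (∧-xor (z e) _ _))))) ⟩
    sum (λ e → z e ∧ (κ (src e) xor κ (tgt e))) ∎)
    where
    expand : ∀ k z a b → k ∧ (z ∧ (a xor b)) ≡ (a ∧ (z ∧ k)) xor (b ∧ (z ∧ k))
    expand = solve 4 (λ k z a b → k :* (z :* (a :+ b)) := a :* (z :* k) :+ b :* (z :* k)) refl
      where open xor-∧-Solver

  -- For a cycle `x`, the choice of where a rotation is cut open affects `pot x` by one constant per
  -- vertex. This changes `cob x` by a coboundary, which no cycle detects.
  pot : Chain → Dart m → Bool
  pot x d = before (rot (end d)) (onDarts x) d

  -- cob x e is the number of times (mod 2) that a parallel copy of e, pushed to one side of the graph, crosses x.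
  cob : Chain → Chain
  cob x e = (pot x (e , false) xor pot x (e , true)) xor x e

  ω : Chain → Chain → Bool
  ω x z = ⟨ z , cob x ⟩

  pot-linear : ∀ d → Linear (λ x → pot x d)
  pot-linear d = linear-∘ proj₁ (before-linear (rot (end d)) d)

  cob-linear : ∀ e → Linear (λ x → cob x e)
  cob-linear e = linear-xor (linear-xor (pot-linear (e , false)) (pot-linear (e , true))) (linear-at e)

  ω-linearʳ : ∀ x → Linear (ω x)
  ω-linearʳ x = ⟨,⟩-linearˡ (cob x)

  ω-linearˡ : ∀ z → Linear (λ x → ω x z)
  ω-linearˡ z = linear-sum λ e → linear-∧ (z e) (cob-linear e)

  -- Local part of the form: pairs at `v` of a dart of `x` preceding a dart of `z`. Regrouping by
  -- vertices makes symmetry a question about single rotations.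
  crossings : Chain → Chain → Fin n → Bool
  crossings x z v = ∑ˡ (rot v) (λ d → onDarts z d ∧ before (rot v) (onDarts x) d)

  rot⇒end : ∀ {v d} → d ∈ rot v → end d ≡ v
  rot⇒end {v} {d} = Equivalence.to (rot-complete v d)

  ω≡crossings : ∀ x z → ω x z ≡ sum (crossings x z) xor ⟨ z , x ⟩
  ω≡crossings x z = begin
    sum (λ e → z e ∧ cob x e)
      ≡⟨ sum-cong (λ e → expand (z e) (pot x (e , false)) (pot x (e , true)) (x e)) ⟩
    sum (λ e → ((z e ∧ pot x (e , false)) xor (z e ∧ pot x (e , true))) xor (z e ∧ x e))
      ≡⟨ sum-xor (λ e → (z e ∧ pot x (e , false)) xor (z e ∧ pot x (e , true))) (λ e → z e ∧ x e) ⟩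
    ∑ᵈ (λ d → onDarts z d ∧ pot x d) xor ⟨ z , x ⟩
      ≡⟨ cong (_xor ⟨ z , x ⟩) (∑ᵈ-by-vertex G (λ d → onDarts z d ∧ pot x d)) ⟨
    sum (λ v → ∑ˡ (rot v) (λ d → onDarts z d ∧ pot x d)) xor ⟨ z , x ⟩
      ≡⟨ cong (_xor ⟨ z , x ⟩) (sum-cong λ v → ∑ˡ-cong (rot v) λ {d} d∈ →
           cong (λ w → onDarts z d ∧ before (rot w) (onDarts x) d) (rot⇒end d∈)) ⟩
    sum (crossings x z) xor ⟨ z , x ⟩ ∎
    where
    expand : ∀ a b c d → a ∧ ((b xor c) xor d) ≡ ((a ∧ b) xor (a ∧ c)) xor (a ∧ d)
    expand = solve 4 (λ a b c d → a :* ((b :+ c) :+ d) := ((a :* b) :+ (a :* c)) :+ (a :* d)) refl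
      where open xor-∧-Solver

  -- At each vertex the defect of symmetry is the product of the degrees of `x` and `z`, of which
  -- the first is even, plus the number of common darts. The latter cancels in the total because a
  -- common edge has two darts.
  ω-symmetric : ∀ {x z} → Cycle x → ω x z ≡ ω z x
  ω-symmetric {x} {z} cx = xor≡false⇒≡ (begin
    ω x z xor ω z x
      ≡⟨ cong₂ _xor_ (ω≡crossings x z) (ω≡crossings z x) ⟩
    (sum (crossings x z) xor ⟨ z , x ⟩) xor (sum (crossings z x) xor ⟨ x , z ⟩)
      ≡⟨ interchange (sum (crossings x z)) _ _ _ ⟩
    (sum (crossings x z) xor sum (crossings z x)) xor (⟨ z , x ⟩ xor ⟨ x , z ⟩)
      ≡⟨ cong₂ _xor_ (sym (sum-xor (crossings x z) (crossings z x)))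
                     (≡⇒xor≡false (⟨,⟩-comm z x)) ⟩
    sum (λ v → crossings x z v xor crossings z x v) xor false
      ≡⟨ xor-identityʳ _ ⟩
    sum (λ v → crossings x z v xor crossings z x v)
      ≡⟨ sum-cong (λ v → trans (before-symmetric (rot-unique v) (onDarts x) (onDarts z))
           (cong (λ b → (b ∧ ∑ˡ (rot v) (onDarts z)) xor ∑ˡ (rot v) common) (trans (∑-rot≡bd x v) (cx v)))) ⟩
    sum (λ v → ∑ˡ (rot v) common)
      ≡⟨ ∑ᵈ-by-vertex G common ⟩
    ∑ᵈ common
      ≡⟨ sum-zero (λ e → xor-same (x e ∧ z e)) ⟩
    false ∎)
    where
    common : Dart m → Bool
    common d = onDarts x d ∧ onDarts z d

  -- At a vertex with 2h darts of `x`, exactly h of them have an odd number of predecessors in `x`.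
  -- By the degree sum these h add up to the number of edges of `x`, which the term `⟨ x , x ⟩`
  -- cancels.
  ω-alternating : ∀ {x} → Cycle x → ω x x ≡ false
  ω-alternating {x} cx = trans (ω≡crossings x x) (≡⇒xor≡false (begin
    sum (crossings x x)
      ≡⟨ sum-cong (λ v → odd-∑ˡ (rot v) (λ d → onDarts x d ∧ before (rot v) (onDarts x) d)) ⟨
    sum (λ v → odd (halves v))                 ≡⟨ odd-sumℕ halves ⟨
    odd (ℕSum.sum halves)                      ≡⟨ cong odd halving ⟩
    odd (ℕSum.sum (toℕᵇ ∘ x))                  ≡⟨ odd-sum x ⟩
    sum x                                      ≡⟨ sum-cong (λ e → BoolP.∧-idem (x e)) ⟨
    ⟨ x , x ⟩                                  ∎))
    where
    halves : Fin n → ℕ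
    halves v = ℕSum.∑ˡ (rot v) (λ d → toℕᵇ (onDarts x d ∧ before (rot v) (onDarts x) d))

    odd-∑ˡ : ∀ (xs : List (Dart m)) h → odd (ℕSum.∑ˡ xs (toℕᵇ ∘ h)) ≡ ∑ˡ xs h
    odd-∑ˡ []       h = refl
    odd-∑ˡ (d ∷ xs) h = trans (odd-+ (toℕᵇ (h d)) _) (cong₂ _xor_ (odd-toℕᵇ (h d)) (odd-∑ˡ xs h))

    odd-sumℕ : ∀ {k} (f : Fin k → ℕ) → odd (ℕSum.sum f) ≡ sum (odd ∘ f)
    odd-sumℕ {zero}  f = refl
    odd-sumℕ {suc k} f = trans (odd-+ (f zero) _) (cong (odd (f zero) xor_) (odd-sumℕ (f ∘ suc)))

    double : ∀ {k} (f : Fin k → ℕ) → 2 * ℕSum.sum f ≡ ℕSum.sum (λ i → f i + f i)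
    double f = trans (cong (ℕSum.sum f +_) (ℕP.+-identityʳ _)) (sym (ℕSum.∑-distrib-+ f f))

    at-vertex : ∀ v → 2 * halves v ≡ ℕSum.∑ˡ (rot v) (toℕᵇ ∘ onDarts x)
    at-vertex v = begin
      2 * halves v                                              ≡⟨ ℕP.+-identityʳ _ ⟨
      2 * halves v + 0                                          ≡⟨ cong (λ b → 2 * halves v + toℕᵇ b) (trans (∑-rot≡bd x v) (cx v)) ⟨
      2 * halves v + toℕᵇ (∑ˡ (rot v) (onDarts x))              ≡⟨ before-alternates (rot-unique v) false (onDarts x) ⟩
      ℕSum.∑ˡ (rot v) (toℕᵇ ∘ onDarts x) + 0                    ≡⟨ ℕP.+-identityʳ _ ⟩
      ℕSum.∑ˡ (rot v) (toℕᵇ ∘ onDarts x)                        ∎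

    halving : ℕSum.sum halves ≡ ℕSum.sum (toℕᵇ ∘ x)
    halving = ℕP.*-cancelˡ-≡ _ _ 2 (begin
      2 * ℕSum.sum halves                                   ≡⟨ double halves ⟩
      ℕSum.sum (λ v → halves v + halves v)                  ≡⟨ ℕSum.sum-cong (λ v → cong (halves v +_) (sym (ℕP.+-identityʳ _))) ⟩
      ℕSum.sum (λ v → 2 * halves v)                         ≡⟨ ℕSum.sum-cong at-vertex ⟩
      ℕSum.sum (λ v → ℕSum.∑ˡ (rot v) (toℕᵇ ∘ onDarts x))   ≡⟨ ℕSum.∑ᵈ-by-vertex G (toℕᵇ ∘ onDarts x) ⟩
      ℕSum.∑ᵈ (toℕᵇ ∘ onDarts x)                            ≡⟨ double (toℕᵇ ∘ x) ⟨
      2 * ℕSum.sum (toℕᵇ ∘ x)                               ∎)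

-- Faces

iter-shift : ∀ {A : Set} k (f : A → A) a → iter k f (f a) ≡ f (iter k f a)
iter-shift zero    f a = refl
iter-shift (suc k) f a = cong f (iter-shift k f a)

iter-+ : ∀ {A : Set} j k (f : A → A) a → iter (j + k) f a ≡ iter j f (iter k f a)
iter-+ zero    k f a = refl
iter-+ (suc j) k f a = cong f (iter-+ j k f a)

argmin : ℕ → (ℕ → ℕ) → ℕ
argmin zero    f = 0
argmin (suc N) f = if f (suc N) ℕ.≤ᵇ f (argmin N f) then suc N else argmin N f

argmin-minimal : ∀ N (f : ℕ → ℕ) {j} → j ≤ N → f (argmin N f) ≤ f j
argmin-minimal zero    f z≤n = ℕP.≤-refl
argmin-minimal (suc N) f {j} j≤ with f (suc N) ℕ.≤ᵇ f (argmin N f) in eq | ℕP.m≤n⇒m<n∨m≡n j≤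
... | true  | inj₁ (s≤s j≤N) = ℕP.≤-trans (ℕP.≤ᵇ⇒≤ _ _ (≡⇒T eq)) (argmin-minimal N f j≤N)
... | true  | inj₂ refl      = ℕP.≤-refl
... | false | inj₁ (s≤s j≤N) = argmin-minimal N f j≤N
... | false | inj₂ refl      = ℕP.<⇒≤ (ℕP.≰⇒> λ le → contradiction (trans (sym eq) (T⇒≡ (ℕP.≤⇒≤ᵇ le))) λ ())

rank-injective : ∀ {m} (d d' : Dart m) → rank d ≡ rank d' → d ≡ d'
rank-injective (e , false) (e' , false) eq = cong (_, false) (FinP.toℕ-injective (ℕP.*-cancelˡ-≡ _ _ 2 eq))
rank-injective (e , true)  (e' , true)  eq = cong (_, true) (FinP.toℕ-injective (ℕP.*-cancelˡ-≡ _ _ 2 (ℕP.suc-injective eq)))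
rank-injective (e , false) (e' , true)  eq = contradiction eq (ℕP.even≢odd (toℕ e) (toℕ e'))
rank-injective (e , true)  (e' , false) eq = contradiction (sym eq) (ℕP.even≢odd (toℕ e') (toℕ e))

rank< : ∀ {m} (d : Dart m) → rank d < 2 * m
rank< (e , false) = ℕP.*-monoʳ-< 2 (FinP.toℕ<n e)
rank< {m} (e , true) = ℕP.≤-trans (ℕP.≤-reflexive (sym (ℕP.*-suc 2 (toℕ e)))) (ℕP.*-monoʳ-≤ 2 (FinP.toℕ<n e))

module Faces {n m : ℕ} (G : EmbeddedGraph n m) (VS : Fin n → Bool) (ES : Fin m → Bool) where
  open EmbeddedGraph G
  open Homology G

  rotate flip face : Dart m → Dart m
  rotate = σ G VS ES
  flip = α G VS ES
  face = φ G VS ES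

  Present : Dart m → Set
  Present d = ES (proj₁ d) ≡ true

  rotES : Fin n → List (Dart m)
  rotES = rotS G VS ES

  rotES-unique : ∀ v → Unique (rotES v)
  rotES-unique v = UniqueP.filter⁺ (T? ∘ ES ∘ proj₁) (rot-unique v)

  ∈-rotES : ∀ {d} → Present d → d ∈ rotES (end d)
  ∈-rotES {d} pd = ∈-filter⁺ (T? ∘ ES ∘ proj₁) (Equivalence.from (rot-complete (end d) d) refl) (≡⇒T pd)

  rotES⇒end : ∀ {v d} → d ∈ rotES v → end d ≡ v
  rotES⇒end d∈ = rot⇒end (proj₁ (∈-filter⁻ (T? ∘ ES ∘ proj₁) d∈))

  rotES⇒Present : ∀ {v d} → d ∈ rotES v → Present d
  rotES⇒Present {v} d∈ = T⇒≡ (proj₂ (∈-filter⁻ (T? ∘ ES ∘ proj₁) {xs = rot v} d∈))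

  rotate-∈ : ∀ {d} → Present d → rotate d ∈ rotES (end d)
  rotate-∈ pd = next-∈ (∈-rotES pd)

  rotate-injective : ∀ {d d'} → Present d → Present d' → rotate d ≡ rotate d' → d ≡ d'
  rotate-injective {d} {d'} pd pd' eq = next-injective (rotES-unique (end d)) (∈-rotES pd)
    (subst (λ v → d' ∈ rotES v) (sym same) (∈-rotES pd'))
    (trans eq (cong (λ v → next (rotES v) d') (sym same)))
    where
    same : end d ≡ end d'
    same = trans (sym (rotES⇒end (rotate-∈ pd))) (trans (cong end eq) (rotES⇒end (rotate-∈ pd')))

  flip-involutive : ∀ d → flip (flip d) ≡ d
  flip-involutive (e , false) = refl
  flip-involutive (e , true)  = refl

  face-Present : ∀ {d} → Present d → Present (face d)
  face-Present pd = rotES⇒Present (rotate-∈ {flip _} pd)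

  face-injective : ∀ {d d'} → Present d → Present d' → face d ≡ face d' → d ≡ d'
  face-injective {d} {d'} pd pd' eq = trans (sym (flip-involutive d))
    (trans (cong flip (rotate-injective pd pd' eq)) (flip-involutive d'))

  iter-Present : ∀ k {d} → Present d → Present (iter k face d)
  iter-Present zero    pd = pd
  iter-Present (suc k) pd = face-Present (iter-Present k pd)

  iter-injective : ∀ k {d d'} → Present d → Present d' → iter k face d ≡ iter k face d' → d ≡ d'
  iter-injective zero    pd pd' eq = eq
  iter-injective (suc k) pd pd' eq =
    iter-injective k pd pd' (face-injective (iter-Present k pd) (iter-Present k pd') eq)

  -- Ranks lie below `2 * m`, so two of the first `2 * m + 1` iterates coincide, and injectivity of
  -- `face` cancels their common initial steps. The bound on `p` ensures that the finite test in
  -- `faceRep` sees the whole orbit.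
  period : ∀ {d} → Present d → ∃ λ p → p < 2 * m × iter (suc p) face d ≡ d
  period {d} pd with FinP.pigeonhole (ℕP.n<1+n (2 * m)) (λ i → Fin.fromℕ< (rank< (iter (toℕ i) face d)))
  ... | i , j , i<j , eq with ℕP.m≤n⇒∃[o]m+o≡n i<j
  ...   | p , i+p≡j = p ,
          ℕP.≤-trans (s≤s (ℕP.m≤n+m p (toℕ i))) (ℕP.≤-trans (ℕP.≤-reflexive i+p≡j) (ℕP.≤-pred (FinP.toℕ<n j))) ,
          sym (iter-injective (toℕ i) pd (iter-Present (suc p) pd) (begin
            iter (toℕ i) face d                      ≡⟨ rank-injective _ _ (FinP.fromℕ<-injective _ _ _ _ eq) ⟩
            iter (toℕ j) face d                      ≡⟨ cong (λ k → iter k face d) (trans (sym i+p≡j) (sym (ℕP.+-suc (toℕ i) p))) ⟩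
            iter (toℕ i + suc p) face d              ≡⟨ iter-+ (toℕ i) (suc p) face d ⟩
            iter (toℕ i) face (iter (suc p) face d)  ∎))

  reduce : ∀ {d} → Present d → ∀ j → ∃ λ i → i < 2 * m × iter j face d ≡ iter i face d
  reduce {d} pd j with period pd
  ... | p , p<2m , cyc = let i , i≤p , eq = within j in i , ℕP.≤-<-trans i≤p p<2m , eq
    where
    within : ∀ j → ∃ λ i → i ≤ p × iter j face d ≡ iter i face d
    within zero = 0 , z≤n , refl
    within (suc j) with within j
    ... | i , i≤p , eq with ℕP.m≤n⇒m<n∨m≡n i≤p
    ...   | inj₁ i<p  = suc i , i<p , cong face eq
    ...   | inj₂ refl = 0 , z≤n , trans (cong face eq) cyc

  -- The dart of least rank on the facial walk of `d`. Among present darts its fixed points are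
  -- those accepted by `faceRep`, so functions on representatives correspond to functions constant
  -- along facial walks.
  rep : Dart m → Dart m
  rep d = iter (argmin (2 * m) (λ k → rank (iter k face d))) face d

  rep-minimal : ∀ {d} → Present d → ∀ j → rank (rep d) ≤ rank (iter j face d)
  rep-minimal {d} pd j with reduce pd j
  ... | i , i<2m , eq = subst (λ d' → rank (rep d) ≤ rank d') (sym eq)
                          (argmin-minimal (2 * m) (λ k → rank (iter k face d)) (ℕP.<⇒≤ i<2m))

  rep-Present : ∀ {d} → Present d → Present (rep d)
  rep-Present {d} pd = iter-Present (argmin (2 * m) (λ k → rank (iter k face d))) pd

  rep-face : ∀ {d} → Present d → rep (face d) ≡ rep d
  rep-face {d} pd = rank-injective _ _ (ℕP.≤-antisym ≤₁ ≤₂)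
    where
    k = argmin (2 * m) (λ k → rank (iter k face d))
    k' = argmin (2 * m) (λ k → rank (iter k face (face d)))
    ahead : ∀ k → ∃ λ j → iter k face d ≡ iter j face (face d)
    ahead (suc k) = k , sym (iter-shift k face d)
    -- The start `d` lies on the orbit of `face d` because the facial walk closes up.
    ahead zero with period pd
    ... | p , _ , cyc = p , trans (sym cyc) (sym (iter-shift p face d))
    ≤₁ : rank (rep (face d)) ≤ rank (rep d)
    ≤₁ with ahead k
    ... | j , eq = subst (λ d' → rank (rep (face d)) ≤ rank d') (sym eq) (rep-minimal (face-Present pd) j)
    ≤₂ : rank (rep d) ≤ rank (rep (face d))
    ≤₂ = subst (λ d' → rank (rep d) ≤ rank d') (sym (iter-shift k' face d)) (rep-minimal pd (suc k'))

  rep-faceRep : ∀ {d} → Present d → T (faceRep G VS ES (rep d))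
  rep-faceRep {d} pd = Equivalence.from T-∧ (≡⇒T (rep-Present pd) ,
    AllP.all⁻ _ (All.universal (λ j → ℕP.≤⇒≤ᵇ (subst (λ d' → rank (rep d) ≤ rank d')
      (iter-+ j k face d) (rep-minimal pd (j + k)))) (upTo (2 * m))))
    where k = argmin (2 * m) (λ k → rank (iter k face d))

  faceRep⇒Present : ∀ {d} → T (faceRep G VS ES d) → Present d
  faceRep⇒Present {d} t = T⇒≡ (proj₁ (Equivalence.to (T-∧ {ES (proj₁ d)}) t))

  faceRep⇒rep : ∀ {d} → T (faceRep G VS ES d) → rep d ≡ d
  faceRep⇒rep {d} t = rank-injective _ _ (ℕP.≤-antisym (rep-minimal pd 0) least)
    where
    pd = faceRep⇒Present {d} t
    k = argmin (2 * m) (λ k → rank (iter k face d))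
    least : rank d ≤ rank (rep d)
    least with reduce pd k
    ... | i , i<2m , eq = subst (λ d' → rank d ≤ rank d') (sym eq)
      (ℕP.≤ᵇ⇒≤ _ _ (All.lookup (AllP.all⁺ _ _ (proj₂ (Equivalence.to (T-∧ {ES (proj₁ d)}) t))) (∈-upTo⁺ i<2m)))

  face-invariant⇒rep : ∀ (F : Dart m → Bool) → (∀ {d} → Present d → F (face d) ≡ F d) →
                       ∀ {d} → Present d → F (rep d) ≡ F d
  face-invariant⇒rep F inv {d} pd = go (argmin (2 * m) (λ k → rank (iter k face d)))
    where
    go : ∀ k → F (iter k face d) ≡ F d
    go zero    = refl
    go (suc k) = trans (inv (iter-Present k pd)) (go k)

  isolated⇒∈ : ∀ {v} → T (isolated G VS ES v) → VS v ≡ true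
  isolated⇒∈ {v} t = T⇒≡ (proj₁ (Equivalence.to (T-∧ {VS v}) t))

  isolated⇒empty : ∀ {v} → T (isolated G VS ES v) → rotES v ≡ []
  isolated⇒empty {v} t with rotES v in eq
  ... | [] = refl
  ... | (e , b) ∷ ds = contradiction
      (All.lookup (AllP.all⁺ _ _ (proj₂ (Equivalence.to (T-∧ {VS v}) t))) (∈-allFin e))
      (incident b (rotES⇒Present d∈) (rotES⇒end d∈))
    where
    d∈ : (e , b) ∈ rotES v
    d∈ = subst ((e , b) ∈_) (sym eq) (here refl)
    incident : ∀ b → ES e ≡ true → end (e , b) ≡ v → ¬ T (not (ES e ∧ ((src e ==ᶠ v) ∨ (tgt e ==ᶠ v))))
    incident false pe refl rewrite pe | ==ᶠ-refl (src e) = λ ()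
    incident true  pe refl rewrite pe | ==ᶠ-refl (tgt e) | BoolP.∨-zeroʳ (src e ==ᶠ tgt e) = λ ()

  empty⇒isolated : ∀ {v} → VS v ≡ true → rotES v ≡ [] → T (isolated G VS ES v)
  empty⇒isolated {v} v∈ eq = Equivalence.from T-∧ (≡⇒T v∈ , AllP.all⁻ _ (All.universal avoid (allFin m)))
    where
    absent : ∀ {d} → ES (proj₁ d) ≡ true → T (end d ==ᶠ v) → ⊥
    absent {d} pd t with subst (d ∈_) (trans (cong rotES (==ᶠ⇒≡ t)) eq) (∈-rotES pd)
    ... | ()
    avoid : ∀ e → T (not (ES e ∧ ((src e ==ᶠ v) ∨ (tgt e ==ᶠ v))))
    avoid e with ES e in pe
    ... | false = _
    ... | true with src e ==ᶠ v in p
    ...   | true  = absent {e , false} pe (≡⇒T p)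
    ...   | false with tgt e ==ᶠ v in q
    ...     | true  = absent {e , true} pe (≡⇒T q)
    ...     | false = _

  Supported : Chain → Set
  Supported x = ∀ e → ES e ≡ false → x e ≡ false

  ∑-rotES≡bd : ∀ {x} → Supported x → ∀ v → ∑ˡ (rotES v) (onDarts x) ≡ bd x v
  ∑-rotES≡bd {x} sx v = trans (∑ˡ-filter (ES ∘ proj₁) (rot v) (onDarts x) (λ d → sx (proj₁ d))) (∑-rot≡bd x v)

  before-rotES : ∀ {x} → Supported x → ∀ {d} → Present d → before (rotES (end d)) (onDarts x) d ≡ pot x d
  before-rotES {x} sx {d} pd = before-filter (ES ∘ proj₁) (rot (end d)) (onDarts x) (λ d → sx (proj₁ d)) pd

  pot-rotate : ∀ {x} → Supported x → Cycle x → ∀ {d} → Present d → pot x (rotate d) ≡ pot x d xor onDarts x d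
  pot-rotate {x} sx cx {d} pd = begin
    pot x (rotate d)                                             ≡⟨ before-rotES sx (rotES⇒Present (rotate-∈ pd)) ⟨
    before (rotES (end (rotate d))) (onDarts x) (rotate d)
      ≡⟨ cong (λ v → before (rotES v) (onDarts x) (rotate d)) (rotES⇒end (rotate-∈ pd)) ⟩
    before (rotES (end d)) (onDarts x) (rotate d)
      ≡⟨ before-next (rotES-unique (end d)) (onDarts x) (trans (∑-rotES≡bd sx (end d)) (cx (end d))) (∈-rotES pd) ⟩
    before (rotES (end d)) (onDarts x) d xor onDarts x d        ≡⟨ cong (_xor onDarts x d) (before-rotES sx pd) ⟩
    pot x d xor onDarts x d                                     ∎

  headOr : (Dart m → Bool) → Bool → List (Dart m) → Bool
  headOr F b []      = b
  headOr F b (d ∷ _) = F d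

  module _ (F : Dart m → Bool) (iso : Fin n → Bool) where

    -- The constant of integration of `F` at `v`. An isolated vertex has no dart to read it from;
    -- there the face of the vertex itself supplies it.
    vertexValue : Fin n → Bool
    vertexValue v = headOr F (iso v) (rotES v)

    module _ {x : Chain} (sx : Supported x) (step : ∀ {d} → Present d → F (rotate d) ≡ F d xor onDarts x d) where

      private
        along : ∀ b xs → Unique xs → (∀ {d} → d ∈ xs → F (next xs d) ≡ F d xor onDarts x d) →
                ∑ˡ xs (onDarts x) ≡ false ×
                (∀ {d} → d ∈ xs → F d ≡ headOr F b xs xor before xs (onDarts x) d)
        along b []        u st = refl , λ ()
        along b (x₀ ∷ xs) u st = increments-sum u F (onDarts x) st , increments u F (onDarts x) st

        at : ∀ v → _
        at v = along (iso v) (rotES v) (rotES-unique v) λ {d} d∈ →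
          trans (cong (λ w → F (next (rotES w) d)) (sym (rotES⇒end d∈))) (step (rotES⇒Present d∈))

      step⇒Cycle : Cycle x
      step⇒Cycle v = trans (sym (∑-rotES≡bd sx v)) (proj₁ (at v))

      -- Around a vertex `F` and `pot x` have the same increments, so they differ by a constant.
      step⇒pot : ∀ {d} → Present d → F d ≡ vertexValue (end d) xor pot x d
      step⇒pot {d} pd = trans (proj₂ (at (end d)) (∈-rotES pd)) (cong (vertexValue (end d) xor_) (before-rotES sx pd))

⊞-elim : {A B : Set} {xs : List A} {ys : List B} {P : A ⊎ B → Set} →
         (∀ {x} → x ∈ xs → P (inj₁ x)) → (∀ {y} → y ∈ ys → P (inj₂ y)) → ∀ {a} → a ∈ xs ⊞ ys → P a
⊞-elim {xs = xs} l r a∈ with ∈-++⁻ (map inj₁ xs) a∈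
... | inj₁ p with ∈-map⁻ inj₁ p
...   | _ , x∈ , refl = l x∈
⊞-elim l r a∈ | inj₂ p with ∈-map⁻ inj₂ p
...   | _ , y∈ , refl = r y∈

==ᶠ-sym : ∀ {n} (a b : Fin n) → (a ==ᶠ b) ≡ (b ==ᶠ a)
==ᶠ-sym a b = iff⇒≡ (λ p → ≡⇒==ᶠ (sym (==ᶠ⇒≡ p))) (λ p → ≡⇒==ᶠ (sym (==ᶠ⇒≡ p)))

sum-δʳ : ∀ {n} (u : Fin n) (h : Fin n → Bool) → sum (λ v → h v ∧ (v ==ᶠ u)) ≡ h u
sum-δʳ u h = trans (sum-cong λ v → trans (∧-comm (h v) _) (cong (_∧ h v) (==ᶠ-sym v u))) (sum-δ u h)

-- `allDarts m` unfolds to this at `allFin m`; an arbitrary list permits induction.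
dartsOf : ∀ {m} → List (Fin m) → List (Dart m)
dartsOf = Data.List.concatMap (λ e → (e , false) ∷ (e , true) ∷ [])
  where import Data.List

∈-dartsOf⁻ : ∀ {m} (es : List (Fin m)) {d} → d ∈ dartsOf es → proj₁ d ∈ es
∈-dartsOf⁻ (e ∷ es) (here refl)         = here refl
∈-dartsOf⁻ (e ∷ es) (there (here refl)) = here refl
∈-dartsOf⁻ (e ∷ es) (there (there d∈))  = there (∈-dartsOf⁻ es d∈)

∈-dartsOf⁺ : ∀ {m} {es : List (Fin m)} {e} → e ∈ es → ∀ b → (e , b) ∈ dartsOf es
∈-dartsOf⁺ (here refl) false = here refl
∈-dartsOf⁺ (here refl) true  = there (here refl)
∈-dartsOf⁺ (there e∈)  b     = there (there (∈-dartsOf⁺ e∈ b))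

dartsOf-unique : ∀ {m} {es : List (Fin m)} → Unique es → Unique (dartsOf es)
dartsOf-unique [] = []
dartsOf-unique {es = e ∷ es} (e∉ ∷ u) =
  ((λ ()) ∷ fresh) ∷ fresh ∷ dartsOf-unique u
  where
  fresh : ∀ {b} → All ((e , b) ≢_) (dartsOf es)
  fresh = All.tabulate λ { d∈ refl → All.lookup e∉ (∈-dartsOf⁻ es d∈) refl }

_≟ᵈ_ : ∀ {m} → DecidableEquality (Dart m)
_≟ᵈ_ = ×-≡-dec Fin._≟_ BoolP._≟_

-- Rooted subgraphs and the Euler count of cells

record Rooted {n m : ℕ} (G : EmbeddedGraph n m) (VS : Fin n → Bool) (ES : Fin m → Bool) : Set where
  open Homology G
  open Faces G VS ES
  field
    base      : Fin n
    base∈     : VS base ≡ true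
    end∈      : ∀ {d} → Present d → VS (end d) ≡ true
    -- Connectedness in the form in which it is used: a chain modulo 2 joining `v` to the base,
    -- known through its support and its boundary.
    path      : Fin n → Chain
    path-supp : ∀ v → Supported (path v)
    path-bd   : ∀ {v} → VS v ≡ true → ∀ w → bd (path v) w ≡ (v ==ᶠ w) xor (base ==ᶠ w)

module Euler {n m : ℕ} {G : EmbeddedGraph n m} {VS : Fin n → Bool} {ES : Fin m → Bool}
             (R : Rooted G VS ES) where
  open EmbeddedGraph G
  open Homology G
  open Faces G VS ES
  open Rooted R

  combine : ∀ {r} → (Fin r → Bool) → (Fin r → Chain) → Chain
  combine c z e = sum λ l → c l ∧ z l e

  combine-linear : ∀ {r} (z : Fin r → Chain) e → Linear (λ c → combine c z e)
  combine-linear z e = ⟨,⟩-linearˡ (λ l → z l e)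

  combine-Supported : ∀ {r} c {z : Fin r → Chain} → (∀ l → Supported (z l)) → Supported (combine c z)
  combine-Supported c sz e pe = sum-zero λ l → trans (cong (c l ∧_) (sz l e pe)) (∧-zeroʳ (c l))

  combine-Cycle : ∀ {r} c {z : Fin r → Chain} → (∀ l → Cycle (z l)) → Cycle (combine c z)
  combine-Cycle c {z} cz v = trans (combination (bd-linear v) c z)
    (sum-zero λ l → trans (cong (c l ∧_) (cz l v)) (∧-zeroʳ (c l)))

  ⊕-Supported : ∀ {x y} → Supported x → Supported y → Supported (x ⊕ y)
  ⊕-Supported sx sy e pe = cong₂ _xor_ (sx e pe) (sy e pe)

  ⊕-Cycle : ∀ {x y} → Cycle x → Cycle y → Cycle (x ⊕ y)
  ⊕-Cycle {x} {y} cx cy v = trans (add (bd-linear v) x y) (cong₂ _xor_ (cx v) (cy v))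

  within : (Fin n → Bool) → Fin n → Bool
  within w v = VS v ∧ w v

  -- A section of the boundary map: joining the vertices of `w` to the base yields the boundary `w`,
  -- corrected at the base by the parity of `w`.
  pathSum : (Fin n → Bool) → Chain
  pathSum w = combine (within w) path

  pathSum-Supported : ∀ w → Supported (pathSum w)
  pathSum-Supported w = combine-Supported (within w) path-supp

  pathSum-linear : ∀ e → Linear (λ w → pathSum w e)
  pathSum-linear e = linear-sum λ v → record
    { resp = λ eq → cong (λ b → (VS v ∧ b) ∧ path v e) (eq v)
    ; add  = λ x y → trans (cong (_∧ path v e) (∧-xor (VS v) (x v) (y v))) (xor-∧ (VS v ∧ x v) _ _) }

  total : (Fin n → Bool) → Bool
  total w = sum (within w)

  total-linear : Linear total
  total-linear = linear-sum λ v → linear-∧ (VS v) (linear-at v)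

  bd-pathSum : ∀ w u → bd (pathSum w) u ≡ within w u xor ((base ==ᶠ u) ∧ total w)
  bd-pathSum w u = begin
    bd (pathSum w) u
      ≡⟨ combination (bd-linear u) (within w) path ⟩
    sum (λ v → within w v ∧ bd (path v) u)
      ≡⟨ sum-cong term ⟩
    sum (λ v → (within w v ∧ (v ==ᶠ u)) xor ((base ==ᶠ u) ∧ within w v))
      ≡⟨ sum-xor (λ v → within w v ∧ (v ==ᶠ u)) (λ v → (base ==ᶠ u) ∧ within w v) ⟩
    sum (λ v → within w v ∧ (v ==ᶠ u)) xor sum (λ v → (base ==ᶠ u) ∧ within w v)
      ≡⟨ cong₂ _xor_ (sum-δʳ u (within w)) (sym (*-distribˡ-sum (base ==ᶠ u) (within w))) ⟩
    within w u xor ((base ==ᶠ u) ∧ total w) ∎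
    where
    term : ∀ v → within w v ∧ bd (path v) u ≡ (within w v ∧ (v ==ᶠ u)) xor ((base ==ᶠ u) ∧ within w v)
    term v with VS v in eq
    ... | false = sym (∧-zeroʳ (base ==ᶠ u))
    ... | true  = trans (cong (w v ∧_) (path-bd eq u))
                 (trans (∧-xor (w v) _ _) (cong ((w v ∧ (v ==ᶠ u)) xor_) (∧-comm (w v) _)))

  δ : (Fin n → Bool) → Chain
  δ κ e = κ (src e) xor κ (tgt e)

  path-δ : ∀ κ {v} → VS v ≡ true → ⟨ path v , δ κ ⟩ ≡ κ v xor κ base
  path-δ κ {v} v∈ = begin
    ⟨ path v , δ κ ⟩                                     ≡⟨ stokes κ (path v) ⟩
    sum (λ w → κ w ∧ bd (path v) w)                      ≡⟨ sum-cong (λ w → trans (cong (κ w ∧_) (path-bd v∈ w)) (trans (∧-comm (κ w) _) (xor-∧ (v ==ᶠ w) _ _))) ⟩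
    sum (λ w → ((v ==ᶠ w) ∧ κ w) xor ((base ==ᶠ w) ∧ κ w)) ≡⟨ sum-xor (λ w → (v ==ᶠ w) ∧ κ w) (λ w → (base ==ᶠ w) ∧ κ w) ⟩
    sum (λ w → (v ==ᶠ w) ∧ κ w) xor sum (λ w → (base ==ᶠ w) ∧ κ w) ≡⟨ cong₂ _xor_ (sum-δ v κ) (sum-δ base κ) ⟩
    κ v xor κ base                                       ∎

  supported-pairing : ∀ {x} → Supported x → ∀ {y y'} → (∀ {e} → ES e ≡ true → y e ≡ y' e) → ⟨ x , y ⟩ ≡ ⟨ x , y' ⟩
  supported-pairing {x} sx {y} {y'} eq = sum-cong term
    where
    term : ∀ e → x e ∧ y e ≡ x e ∧ y' e
    term e with ES e in pe
    ... | true  = cong (x e ∧_) (eq pe)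
    ... | false rewrite sx e pe = refl

  supported-≗ : ∀ {x y} → Supported x → Supported y → (∀ {e} → ES e ≡ true → x e ≡ y e) → x ≗ y
  supported-≗ sx sy eq e with ES e in pe
  ... | true  = eq pe
  ... | false = trans (sx e pe) (sym (sy e pe))

  edges : List (Fin m)
  edges = filterᵇ ES (allFin m)

  vertices : List (Fin n)
  vertices = filterᵇ VS (allFin n)

  faceReps : List (Dart m)
  faceReps = filterᵇ (faceRep G VS ES) (allDarts m)

  isolatedVertices : List (Fin n)
  isolatedVertices = filterᵇ (isolated G VS ES) (allFin n)

  cells : ∀ r → List (Fin r ⊎ (Fin n ⊎ (Dart m ⊎ Fin n)))
  cells r = allFin r ⊞ (vertices ⊞ (faceReps ⊞ isolatedVertices))

  cells-unique : ∀ r → Unique (cells r)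
  cells-unique r = ⊞-unique (UniqueP.allFin⁺ r)
    (⊞-unique (UniqueP.filter⁺ (T? ∘ VS) (UniqueP.allFin⁺ n))
    (⊞-unique (UniqueP.filter⁺ (T? ∘ faceRep G VS ES) (dartsOf-unique (UniqueP.allFin⁺ m)))
              (UniqueP.filter⁺ (T? ∘ isolated G VS ES) (UniqueP.allFin⁺ n))))

  -- The two extra bits are the 2 in Euler's formula. One records the parity of a vertex set, which
  -- a boundary cannot show; the other records the constant of a face function, which its boundary
  -- loses.
  targets : List (Fin m ⊎ Bool)
  targets = edges ⊞ (false ∷ true ∷ [])

  targets-unique : Unique targets
  targets-unique = ⊞-unique (UniqueP.filter⁺ (T? ∘ ES) (UniqueP.allFin⁺ m)) (((λ ()) ∷ []) ∷ [] ∷ [])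

  ∈-edges⁺ : ∀ {e} → ES e ≡ true → e ∈ edges
  ∈-edges⁺ {e} pe = ∈-filter⁺ (T? ∘ ES) (∈-allFin e) (≡⇒T pe)

  ∈-edges⁻ : ∀ {e} → e ∈ edges → ES e ≡ true
  ∈-edges⁻ e∈ = T⇒≡ (proj₂ (∈-filter⁻ (T? ∘ ES) {xs = allFin m} e∈))

  ∈-vertices⁺ : ∀ {v} → VS v ≡ true → v ∈ vertices
  ∈-vertices⁺ {v} v∈ = ∈-filter⁺ (T? ∘ VS) (∈-allFin v) (≡⇒T v∈)

  ∈-vertices⁻ : ∀ {v} → v ∈ vertices → VS v ≡ true
  ∈-vertices⁻ v∈ = T⇒≡ (proj₂ (∈-filter⁻ (T? ∘ VS) {xs = allFin n} v∈))

  ∈-faceReps⁺ : ∀ {d} → T (faceRep G VS ES d) → d ∈ faceReps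
  ∈-faceReps⁺ {d} = ∈-filter⁺ (T? ∘ faceRep G VS ES) (∈-dartsOf⁺ (∈-allFin (proj₁ d)) (proj₂ d))

  ∈-faceReps⁻ : ∀ {d} → d ∈ faceReps → T (faceRep G VS ES d)
  ∈-faceReps⁻ d∈ = proj₂ (∈-filter⁻ (T? ∘ faceRep G VS ES) {xs = allDarts m} d∈)

  ∈-isolated⁺ : ∀ {v} → T (isolated G VS ES v) → v ∈ isolatedVertices
  ∈-isolated⁺ {v} = ∈-filter⁺ (T? ∘ isolated G VS ES) (∈-allFin v)

  ∈-isolated⁻ : ∀ {v} → v ∈ isolatedVertices → T (isolated G VS ES v)
  ∈-isolated⁻ v∈ = proj₂ (∈-filter⁻ (T? ∘ isolated G VS ES) {xs = allFin n} v∈)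

  length-cells : ∀ r → length (cells r) ≡ r + (numVertices G VS ES + numFaces G VS ES)
  length-cells r = begin
    length (cells r)
      ≡⟨ length-⊞ (allFin r) _ ⟩
    length (allFin r) + length (vertices ⊞ (faceReps ⊞ isolatedVertices))
      ≡⟨ cong₂ _+_ (ListP.length-tabulate {n = r} id) (trans (length-⊞ vertices _) (cong (length vertices +_) (length-⊞ faceReps isolatedVertices))) ⟩
    r + (numVertices G VS ES + numFaces G VS ES) ∎

  length-targets : length targets ≡ numEdges G VS ES + 2
  length-targets = length-⊞ edges _

  module FaceFunction (F : Dart m → Bool) (iso : Fin n → Bool)
                      (inv : ∀ {d} → Present d → F (face d) ≡ F d) where

    ∂F : Chain
    ∂F e = ES e ∧ (F (e , false) xor F (e , true))

    ∂F-Supported : Supported ∂F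
    ∂F-Supported e pe rewrite pe = refl

    flip-F : ∀ {d} → Present d → F (flip d) ≡ F d xor onDarts ∂F d
    flip-F {e , false} pe rewrite pe = sym (cancel (F (e , false)) (F (e , true)))
      where
      cancel : ∀ a b → a xor (a xor b) ≡ b
      cancel = solve 2 (λ a b → a :+ (a :+ b) := b) refl where open xor-∧-Solver
    flip-F {e , true} pe rewrite pe = sym (cancel (F (e , true)) (F (e , false)))
      where
      cancel : ∀ a b → a xor (b xor a) ≡ b
      cancel = solve 2 (λ a b → a :+ (b :+ a) := b) refl where open xor-∧-Solver

    -- `rotate d` lies on the facial walk of `flip d`, so turning past `d` amounts to crossing its
    -- edge.
    step : ∀ {d} → Present d → F (rotate d) ≡ F d xor onDarts ∂F d
    step {d} pd = begin
      F (rotate d)       ≡⟨ cong (F ∘ rotate) (flip-involutive d) ⟨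
      F (face (flip d)) ≡⟨ inv {flip d} pd ⟩
      F (flip d)        ≡⟨ flip-F pd ⟩
      F d xor onDarts ∂F d ∎

    value : Fin n → Bool
    value = vertexValue F iso

    ∂F-Cycle : Cycle ∂F
    ∂F-Cycle = step⇒Cycle F iso ∂F-Supported step

    F≡value : ∀ {d} → Present d → F d ≡ value (end d) xor pot ∂F d
    F≡value = step⇒pot F iso ∂F-Supported step

    -- Writing `F` as `value` plus `pot ∂F` at both darts of `e` cancels the potentials. Thus the
    -- crossing numbers of a sum of faces form a coboundary on the subgraph, and the sum lies in the
    -- radical.
    cob-∂F : ∀ {e} → ES e ≡ true → cob ∂F e ≡ δ value e
    cob-∂F {e} pe = begin
      (pot ∂F (e , false) xor pot ∂F (e , true)) xor ∂F e
        ≡⟨ cong ((pot ∂F (e , false) xor pot ∂F (e , true)) xor_) (trans (cong (_∧ (F (e , false) xor F (e , true))) pe)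
             (cong₂ _xor_ (F≡value {e , false} pe) (F≡value {e , true} pe))) ⟩
      (pot ∂F (e , false) xor pot ∂F (e , true)) xor
        ((value (src e) xor pot ∂F (e , false)) xor (value (tgt e) xor pot ∂F (e , true)))
        ≡⟨ cancel (pot ∂F (e , false)) (pot ∂F (e , true)) (value (src e)) (value (tgt e)) ⟩
      δ value e ∎
      where
      cancel : ∀ a b s t → (a xor b) xor ((s xor a) xor (t xor b)) ≡ s xor t
      cancel = solve 4 (λ a b s t → (a :+ b) :+ ((s :+ a) :+ (t :+ b)) := s :+ t) refl where open xor-∧-Solver

    ω-∂F : ∀ {z} → Supported z → Cycle z → ω ∂F z ≡ false
    ω-∂F {z} sz cz = begin
      ⟨ z , cob ∂F ⟩   ≡⟨ supported-pairing sz cob-∂F ⟩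
      ⟨ z , δ value ⟩  ≡⟨ stokes value z ⟩
      ⟨ value , bd z ⟩ ≡⟨ sum-zero (λ v → trans (cong (value v ∧_) (cz v)) (∧-zeroʳ (value v))) ⟩
      false            ∎

    -- If `∂F` vanishes, so does the coboundary of `value`, which therefore does not change along
    -- the path to the base.
    ∂F≡0⇒value : (∀ e → ∂F e ≡ false) → ∀ {v} → VS v ≡ true → value v ≡ value base
    ∂F≡0⇒value ∂F≡0 {v} v∈ = xor≡false⇒≡ (begin
      value v xor value base  ≡⟨ path-δ value v∈ ⟨
      ⟨ path v , δ value ⟩    ≡⟨ supported-pairing (path-supp v) (λ {e} pe → trans (sym (cob-∂F pe)) (null (cob-linear e) ∂F≡0)) ⟩
      ⟨ path v , (λ _ → false) ⟩ ≡⟨ sum-zero (λ e → ∧-zeroʳ (path v e)) ⟩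
      false                   ∎)

  -- Nondegenerate families of cycles: the lower bound for the rank

  Nondegenerate : ∀ {r} → (Fin r → Chain) → Set
  Nondegenerate {r} z = ∀ (c : Fin r → Bool) → (∀ j → sum (λ l → c l ∧ ω (z l) (z j)) ≡ false) → ∀ l → c l ≡ false

  module _ {r : ℕ} (z : Fin r → Chain) (sz : ∀ l → Supported (z l)) (cz : ∀ l → Cycle (z l)) where

    private
      module Φ (u : Fin r ⊎ (Fin n ⊎ (Dart m ⊎ Fin n)) → Bool) where
        c   = λ l → u (inj₁ l)
        w   = λ v → u (inj₂ (inj₁ v))
        F   = λ d → u (inj₂ (inj₂ (inj₁ (rep d))))
        iso = λ v → u (inj₂ (inj₂ (inj₂ v)))
        open FaceFunction F iso (λ pd → cong (λ d → u (inj₂ (inj₂ (inj₁ d)))) (rep-face pd)) public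

        eval : Fin m ⊎ Bool → Bool
        eval (inj₁ e)     = combine c z e xor (pathSum w e xor ∂F e)
        eval (inj₂ false) = total w
        eval (inj₂ true)  = value base

      Φ-linear : ∀ b → Linear (λ u → Φ.eval u b)
      Φ-linear (inj₁ e) = linear-xor (linear-∘ inj₁ (combine-linear z e))
        (linear-xor (linear-∘ (inj₂ ∘ inj₁) (pathSum-linear e))
                    (linear-∧ (ES e) (linear-xor (linear-at _) (linear-at _))))
      Φ-linear (inj₂ false) = linear-∘ (inj₂ ∘ inj₁) total-linear
      -- The base value is the bit of the face at the first dart there, or of the face of the base
      -- itself if it is isolated; in both cases it is a single coordinate.
      Φ-linear (inj₂ true) with rotES base
      ... | []    = linear-at _
      ... | _ ∷ _ = linear-at _

    -- The map sends coefficients, vertex set and face function to the sum of the combination, the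
    -- paths and the face boundary, together with the two bits. In its kernel, taking boundaries
    -- kills the vertex set. The combination is then a sum of faces, orthogonal to all `z j`, so
    -- nondegeneracy kills the coefficients. What remains is a face function with zero boundary; it
    -- is constant, and its value at the base is zero.
    nondegenerate⇒≤ : Nondegenerate z → r + (numVertices G VS ES + numFaces G VS ES) ≤ numEdges G VS ES + 2
    nondegenerate⇒≤ nd = subst₂ _≤_ (length-cells r) length-targets
      (linear-injection⇒≤ (⊎-≡-dec Fin._≟_ (⊎-≡-dec Fin._≟_ (⊎-≡-dec _≟ᵈ_ Fin._≟_))) (cells-unique r) Φ.eval Φ-linear kernel)
      where
      kernel : ∀ u → (∀ {b} → b ∈ targets → Φ.eval u b ≡ false) → ∀ {a} → a ∈ cells r → u a ≡ false
      kernel u ≡0 = ⊞-elim {P = λ a → u a ≡ false} (λ {l} _ → c≡0 l)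
        (⊞-elim {P = λ a → u (inj₂ a) ≡ false} (λ v∈ → w≡0 (∈-vertices⁻ v∈))
        (⊞-elim {P = λ a → u (inj₂ (inj₂ a)) ≡ false} f≡0 iso≡0))
        where
        open Φ u
        total≡0 : total w ≡ false
        total≡0 = ≡0 (∈-⊞ʳ {xs = edges} (here refl))

        value≡0 : value base ≡ false
        value≡0 = ≡0 (∈-⊞ʳ {xs = edges} (there (here refl)))

        image : Chain
        image = combine c z ⊕ (pathSum w ⊕ ∂F)

        image≡0 : ∀ e → image e ≡ false
        image≡0 = supported-≗
          (⊕-Supported (combine-Supported c sz) (⊕-Supported (pathSum-Supported w) ∂F-Supported))
          (λ _ _ → refl) (λ pe → ≡0 (∈-⊞ˡ (∈-edges⁺ pe)))

        within≡0 : ∀ v → within w v ≡ false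
        within≡0 v = begin
          within w v                                     ≡⟨ xor-identityʳ _ ⟨
          within w v xor false                           ≡⟨ cong (within w v xor_) (∧-zeroʳ (base ==ᶠ v)) ⟨
          within w v xor ((base ==ᶠ v) ∧ false)          ≡⟨ cong (λ b → within w v xor ((base ==ᶠ v) ∧ b)) total≡0 ⟨
          within w v xor ((base ==ᶠ v) ∧ total w)        ≡⟨ bd-pathSum w v ⟨
          bd (pathSum w) v                               ≡⟨ xor-identityʳ _ ⟨
          bd (pathSum w) v xor false                     ≡⟨ cong (bd (pathSum w) v xor_) (∂F-Cycle v) ⟨
          bd (pathSum w) v xor bd ∂F v                   ≡⟨ add (bd-linear v) (pathSum w) ∂F ⟨
          bd (pathSum w ⊕ ∂F) v                          ≡⟨ cong (_xor bd (pathSum w ⊕ ∂F) v) (combine-Cycle c cz v) ⟨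
          bd (combine c z) v xor bd (pathSum w ⊕ ∂F) v   ≡⟨ add (bd-linear v) (combine c z) (pathSum w ⊕ ∂F) ⟨
          bd image v                                     ≡⟨ null (bd-linear v) image≡0 ⟩
          false                                          ∎

        w≡0 : ∀ {v} → VS v ≡ true → w v ≡ false
        w≡0 {v} v∈ = trans (cong (_∧ w v) (sym v∈)) (within≡0 v)

        combine≗∂F : combine c z ≗ ∂F
        combine≗∂F e = xor≡false⇒≡ (begin
          combine c z e xor ∂F e                    ≡⟨ cong (λ b → combine c z e xor (b xor ∂F e))
                                                         (sum-zero λ v → cong (_∧ path v e) (within≡0 v)) ⟨
          combine c z e xor (pathSum w e xor ∂F e)  ≡⟨ image≡0 e ⟩
          false                                     ∎)

        c≡0 : ∀ l → c l ≡ false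
        c≡0 = nd c λ j → begin
          sum (λ l → c l ∧ ω (z l) (z j)) ≡⟨ combination (ω-linearˡ (z j)) c z ⟨
          ω (combine c z) (z j)           ≡⟨ resp (ω-linearˡ (z j)) combine≗∂F ⟩
          ω ∂F (z j)                      ≡⟨ ω-∂F (sz j) (cz j) ⟩
          false                           ∎

        ∂F≡0 : ∀ e → ∂F e ≡ false
        ∂F≡0 e = trans (sym (combine≗∂F e)) (sum-zero λ l → cong (_∧ z l e) (c≡0 l))

        values≡0 : ∀ {v} → VS v ≡ true → value v ≡ false
        values≡0 v∈ = trans (∂F≡0⇒value ∂F≡0 v∈) value≡0

        f≡0 : ∀ {d} → d ∈ faceReps → u (inj₂ (inj₂ (inj₁ d))) ≡ false
        f≡0 {d} d∈ = begin
          u (inj₂ (inj₂ (inj₁ d)))       ≡⟨ cong (λ d → u (inj₂ (inj₂ (inj₁ d)))) (faceRep⇒rep (∈-faceReps⁻ d∈)) ⟨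
          F d                            ≡⟨ F≡value pd ⟩
          value (end d) xor pot ∂F d     ≡⟨ cong₂ _xor_ (values≡0 (end∈ {d} pd)) (null (pot-linear d) ∂F≡0) ⟩
          false                          ∎
          where pd = faceRep⇒Present {d} (∈-faceReps⁻ d∈)

        iso≡0 : ∀ {v} → v ∈ isolatedVertices → iso v ≡ false
        iso≡0 {v} v∈ = begin
          iso v   ≡⟨ cong (headOr F (iso v)) (isolated⇒empty (∈-isolated⁻ v∈)) ⟨
          value v ≡⟨ values≡0 (isolated⇒∈ (∈-isolated⁻ v∈)) ⟩
          false   ∎

  -- Fundamental cycles and spanning families: the upper bound for the rank

  fundamental : Fin m → Chain
  fundamental e = (e ==ᶠ_) ⊕ (path (src e) ⊕ path (tgt e))

  fundamental-pairing : ∀ e y → ⟨ fundamental e , y ⟩ ≡ y e xor (⟨ path (src e) , y ⟩ xor ⟨ path (tgt e) , y ⟩)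
  fundamental-pairing e y = trans (add (⟨,⟩-linearˡ y) (e ==ᶠ_) (path (src e) ⊕ path (tgt e)))
    (cong₂ _xor_ (sum-δ e y) (add (⟨,⟩-linearˡ y) (path (src e)) (path (tgt e))))

  bd-outside : ∀ {x} → Supported x → ∀ {v} → VS v ≡ false → bd x v ≡ false
  bd-outside {x} sx {v} v∉ = sum-zero term
    where
    apart : ∀ {d} → Present d → (end d ==ᶠ v) ≡ false
    apart {d} pd with end d ==ᶠ v in eq
    ... | false = refl
    ... | true  = contradiction (trans (sym (end∈ {d} pd)) (trans (cong VS (==ᶠ⇒≡ (≡⇒T eq))) v∉)) λ ()
    term : ∀ e → x e ∧ ((src e ==ᶠ v) xor (tgt e ==ᶠ v)) ≡ false
    term e with ES e in pe
    ... | false rewrite sx e pe = refl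
    ... | true = trans (cong (x e ∧_) (cong₂ _xor_ (apart {e , false} pe) (apart {e , true} pe))) (∧-zeroʳ (x e))

  sum-bd : ∀ x → sum (bd x) ≡ false
  sum-bd x = trans (sym (stokes (λ _ → true) x)) (sum-zero λ e → ∧-zeroʳ (x e))

  -- fundamental cycles generate all cycles, so this says that x is a combination of the zs modulo the radical of ω
  Spanning : ∀ {r} → (Fin r → Chain) → Set
  Spanning {r} z = ∀ x → Supported x → Cycle x → ∃ λ (c : Fin r → Bool) →
    ∀ {e} → ES e ≡ true → ω (x ⊕ combine c z) (fundamental e) ≡ false

  module _ {r : ℕ} (z : Fin r → Chain) (sz : ∀ l → Supported (z l)) (cz : ∀ l → Cycle (z l)) (span : Spanning z) where

    private
      module Ψ (u : Fin m ⊎ Bool → Bool) where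
        given : Chain
        given e = ES e ∧ u (inj₁ e)

        a = u (inj₂ false)
        b = u (inj₂ true)

        given-Supported : Supported given
        given-Supported e pe rewrite pe = refl

        -- The boundary of the given edges with the bit `a` stored at the base. Boundaries have even
        -- size, so `a` is recovered as the parity of `w`.
        w : Fin n → Bool
        w v = bd given v xor ((base ==ᶠ v) ∧ a)

        within-w : ∀ v → within w v ≡ w v
        within-w v with VS v in v∈
        ... | true  = refl
        ... | false rewrite bd-outside given-Supported v∈ with base ==ᶠ v in eq
        ...   | false = refl
        ...   | true  = contradiction (trans (sym base∈) (trans (cong VS (==ᶠ⇒≡ (≡⇒T eq))) v∈)) λ ()

        total-w : total w ≡ a
        total-w = begin
          total w                                            ≡⟨ sum-cong within-w ⟩
          sum w                                              ≡⟨ sum-xor (bd given) (λ v → (base ==ᶠ v) ∧ a) ⟩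
          sum (bd given) xor sum (λ v → (base ==ᶠ v) ∧ a)    ≡⟨ cong₂ _xor_ (sum-bd given) (sum-δ base (λ _ → a)) ⟩
          a                                                  ∎

        closed : Chain
        closed = given ⊕ pathSum w

        closed-Supported : Supported closed
        closed-Supported = ⊕-Supported given-Supported (pathSum-Supported w)

        closed-Cycle : Cycle closed
        closed-Cycle v = begin
          bd closed v                                                     ≡⟨ add (bd-linear v) given (pathSum w) ⟩
          bd given v xor bd (pathSum w) v                                 ≡⟨ cong (bd given v xor_) (bd-pathSum w v) ⟩
          bd given v xor (within w v xor ((base ==ᶠ v) ∧ total w))
            ≡⟨ cong₂ (λ p q → bd given v xor (p xor ((base ==ᶠ v) ∧ q))) (within-w v) total-w ⟩
          bd given v xor ((bd given v xor ((base ==ᶠ v) ∧ a)) xor ((base ==ᶠ v) ∧ a))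
            ≡⟨ cancel (bd given v) ((base ==ᶠ v) ∧ a) ⟩
          false ∎
          where
          cancel : ∀ p q → p xor ((p xor q) xor q) ≡ false
          cancel = solve 2 (λ p q → p :+ ((p :+ q) :+ q) := con false) refl where open xor-∧-Solver

        c : Fin r → Bool
        c = proj₁ (span closed closed-Supported closed-Cycle)

        radical : Chain
        radical = closed ⊕ combine c z

        radical-Supported : Supported radical
        radical-Supported = ⊕-Supported closed-Supported (combine-Supported c sz)

        radical-Cycle : Cycle radical
        radical-Cycle = ⊕-Cycle {closed} {combine c z} closed-Cycle (combine-Cycle c cz)

        -- The integral of `cob radical` along the path between `v` and the base. Since
        -- `cob radical` vanishes on fundamental cycles, the two integrals at the ends of an edge
        -- differ by its value on that edge.
        κ : Fin n → Bool
        κ v = ⟨ path v , cob radical ⟩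

        cob≡δκ : ∀ {e} → ES e ≡ true → cob radical e ≡ δ κ e
        cob≡δκ {e} pe = xor≡false⇒≡ (trans (sym (fundamental-pairing e (cob radical)))
                                            (proj₂ (span closed closed-Supported closed-Cycle) pe))

        -- A face function with boundary `radical`: the potential has the right increments around
        -- vertices, and `κ` makes it fit across edges as well. The remaining free constant carries
        -- the bit `b`.
        F : Dart m → Bool
        F d = (pot radical d xor κ (end d)) xor b

        iso : Fin n → Bool
        iso v = κ v xor b

        F-flip : ∀ {d} → Present d → F (flip d) ≡ F d xor onDarts radical d
        F-flip {e , s} pe = xor≡false⇒≡ (trans (regroup s) (≡⇒xor≡false (cob≡δκ pe)))
          where
          p = pot radical (e , false)
          q = pot radical (e , true)
          regroup : ∀ s → F (flip (e , s)) xor (F (e , s) xor radical e) ≡ cob radical e xor δ κ e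
          regroup false = solve 6 (λ p q x k l b → ((q :+ l) :+ b) :+ (((p :+ k) :+ b) :+ x) := ((p :+ q) :+ x) :+ (k :+ l))
            refl p q (radical e) (κ (src e)) (κ (tgt e)) b
            where open xor-∧-Solver
          regroup true = solve 6 (λ p q x k l b → ((p :+ k) :+ b) :+ (((q :+ l) :+ b) :+ x) := ((p :+ q) :+ x) :+ (k :+ l))
            refl p q (radical e) (κ (src e)) (κ (tgt e)) b
            where open xor-∧-Solver

        F-rotate : ∀ {d} → Present d → F (rotate d) ≡ F d xor onDarts radical d
        F-rotate {d} pd = begin
          (pot radical (rotate d) xor κ (end (rotate d))) xor b
            ≡⟨ cong₂ (λ p v → (p xor κ v) xor b) (pot-rotate radical-Supported radical-Cycle pd) (rotES⇒end (rotate-∈ pd)) ⟩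
          ((pot radical d xor onDarts radical d) xor κ (end d)) xor b
            ≡⟨ swap (pot radical d) (onDarts radical d) (κ (end d)) b ⟩
          F d xor onDarts radical d ∎
          where
          swap : ∀ p x k b → ((p xor x) xor k) xor b ≡ ((p xor k) xor b) xor x
          swap = solve 4 (λ p x k b → ((p :+ x) :+ k) :+ b := ((p :+ k) :+ b) :+ x) refl where open xor-∧-Solver

        -- A step of `face` is a flip followed by a rotation, and each of the two adds `radical` of
        -- the same edge.
        F-face : ∀ {d} → Present d → F (face d) ≡ F d
        F-face {d} pd = begin
          F (rotate (flip d))                     ≡⟨ F-rotate {flip d} pd ⟩
          F (flip d) xor radical (proj₁ d)       ≡⟨ cong (_xor radical (proj₁ d)) (F-flip pd) ⟩
          (F d xor radical (proj₁ d)) xor radical (proj₁ d) ≡⟨ cancel (F d) (radical (proj₁ d)) ⟩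
          F d                                    ∎
          where
          cancel : ∀ p q → (p xor q) xor q ≡ p
          cancel = solve 2 (λ p q → (p :+ q) :+ q := p) refl where open xor-∧-Solver

        F-rep : ∀ {d} → Present d → F (rep d) ≡ F d
        F-rep = face-invariant⇒rep F F-face

        radical≡∂F : ∀ {e} → ES e ≡ true → radical e ≡ F (e , false) xor F (e , true)
        radical≡∂F {e} pe = sym (trans (cong (F (e , false) xor_) (F-flip {e , false} pe)) (cancel (F (e , false)) (radical e)))
          where
          cancel : ∀ p q → p xor (p xor q) ≡ q
          cancel = solve 2 (λ p q → p :+ (p :+ q) := q) refl where open xor-∧-Solver

        eval : Fin r ⊎ (Fin n ⊎ (Dart m ⊎ Fin n)) → Bool
        eval (inj₁ l)               = c l
        eval (inj₂ (inj₁ v))        = w v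
        eval (inj₂ (inj₂ (inj₁ d))) = F d
        eval (inj₂ (inj₂ (inj₂ v))) = iso v

    -- The encoding in the other direction: close the given edges up by paths, subtract a
    -- combination of the `z` to reach the radical, and write the rest as the boundary of a face
    -- function. Coefficients, vertex set and face values determine the given edges and both bits.
    -- The coefficients come from `span`, which does not promise linear dependence on the cycle, so
    -- injectivity is shown for pairs instead of through a kernel.
    spanning⇒≤ : numEdges G VS ES + 2 ≤ r + (numVertices G VS ES + numFaces G VS ES)
    spanning⇒≤ = subst₂ _≤_ length-targets (length-cells r)
      (injection⇒≤ (⊎-≡-dec Fin._≟_ BoolP._≟_) targets-unique Ψ.eval injective)
      where
      injective : ∀ u u' → (∀ {t} → t ∈ cells r → Ψ.eval u t ≡ Ψ.eval u' t) → ∀ {t} → t ∈ targets → u t ≡ u' t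
      injective u u' same = ⊞-elim {P = λ t → u t ≡ u' t} (λ e∈ → given≡ (∈-edges⁻ e∈))
        λ { (here refl) → a≡ ; (there (here refl)) → b≡ }
        where
        module U  = Ψ u
        module U' = Ψ u'
        within≡ : ∀ v → within U.w v ≡ within U'.w v
        within≡ v with VS v in v∈
        ... | false = refl
        ... | true  = same (∈-⊞ʳ {xs = allFin r} (∈-⊞ˡ (∈-vertices⁺ v∈)))

        a≡ : U.a ≡ U'.a
        a≡ = trans (sym U.total-w) (trans (sum-cong within≡) U'.total-w)

        F≡ : ∀ {d} → Present d → U.F d ≡ U'.F d
        F≡ pd = trans (sym (U.F-rep pd)) (trans
          (same (∈-⊞ʳ {xs = allFin r} (∈-⊞ʳ {xs = vertices} (∈-⊞ˡ (∈-faceReps⁺ (rep-faceRep pd))))))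
          (U'.F-rep pd))

        radical≡ : U.radical ≗ U'.radical
        radical≡ = supported-≗ U.radical-Supported U'.radical-Supported λ {e} pe →
          trans (U.radical≡∂F pe) (trans (cong₂ _xor_ (F≡ {e , false} pe) (F≡ {e , true} pe)) (sym (U'.radical≡∂F pe)))

        given≡ : ∀ {e} → ES e ≡ true → u (inj₁ e) ≡ u' (inj₁ e)
        given≡ {e} pe = begin
          u (inj₁ e)               ≡⟨ cong (_∧ u (inj₁ e)) pe ⟨
          U.given e                ≡⟨ recover (U.given e) _ _ ⟨
          (U.radical e xor combine U.c z e) xor pathSum U.w e
            ≡⟨ cong₂ _xor_ (cong₂ _xor_ (radical≡ e) (sum-cong λ l → cong (_∧ z l e) (same (∈-⊞ˡ (∈-allFin l)))))
                           (sum-cong λ v → cong (_∧ path v e) (within≡ v)) ⟩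
          (U'.radical e xor combine U'.c z e) xor pathSum U'.w e ≡⟨ recover (U'.given e) _ _ ⟩
          U'.given e               ≡⟨ cong (_∧ u' (inj₁ e)) pe ⟩
          u' (inj₁ e)              ∎
          where
          recover : ∀ x p q → (((x xor p) xor q) xor q) xor p ≡ x
          recover = solve 3 (λ x p q → (((x :+ p) :+ q) :+ q) :+ p := x) refl where open xor-∧-Solver

        κ≡ : ∀ v → U.κ v ≡ U'.κ v
        κ≡ v = resp (⟨,⟩-linearʳ (path v)) λ e → resp (cob-linear e) radical≡

        cancelˡ : ∀ x {y z} → x xor y ≡ x xor z → y ≡ z
        cancelˡ false eq = eq
        cancelˡ true  eq = BoolP.not-injective eq

        b≡ : U.b ≡ U'.b
        -- The constant is read at a dart of the base or, if there is none, from the face of the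
        -- isolated base.
        b≡ with rotES base in eq
        ... | [] = cancelˡ (U.κ base) (trans
              (same (∈-⊞ʳ {xs = allFin r} (∈-⊞ʳ {xs = vertices} (∈-⊞ʳ {xs = faceReps} (∈-isolated⁺ (empty⇒isolated base∈ eq))))))
              (cong (_xor U'.b) (sym (κ≡ base))))
        ... | d ∷ _ = cancelˡ (pot U.radical d xor U.κ (end d)) (trans (F≡ (rotES⇒Present (subst (d ∈_) (sym eq) (here refl))))
              (cong (_xor U'.b) (sym (cong₂ _xor_ (resp (pot-linear d) radical≡) (κ≡ (end d))))))

  -- Membership in the span modulo the radical, with fundamental cycles as tests. It is closed under
  -- sums, so spanning can be checked on generators.
  InSpan : ∀ {r} → (Fin r → Chain) → Chain → Set
  InSpan {r} z x = ∃ λ (c : Fin r → Bool) →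
    ∀ {e} → ES e ≡ true → ω x (fundamental e) ≡ sum (λ l → c l ∧ ω (z l) (fundamental e))

  module _ {r : ℕ} (z : Fin r → Chain) where

    InSpan-resp : ∀ {x y} → x ≗ y → InSpan z x → InSpan z y
    InSpan-resp eq (c , h) = c , λ {e} pe → trans (sym (resp (ω-linearˡ (fundamental e)) eq)) (h pe)

    InSpan-⊕ : ∀ {x y} → InSpan z x → InSpan z y → InSpan z (x ⊕ y)
    InSpan-⊕ {x} {y} (c , h) (c' , h') = (c ⊕ c') , λ {e} pe → begin
      ω (x ⊕ y) (fundamental e)                   ≡⟨ add (ω-linearˡ (fundamental e)) x y ⟩
      ω x (fundamental e) xor ω y (fundamental e) ≡⟨ cong₂ _xor_ (h pe) (h' pe) ⟩
      ⟨ c , row e ⟩ xor ⟨ c' , row e ⟩            ≡⟨ add (⟨,⟩-linearˡ (row e)) c c' ⟨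
      ⟨ c ⊕ c' , row e ⟩                          ∎
      where
      row : Fin m → Fin r → Bool
      row e l = ω (z l) (fundamental e)

    InSpan-null : ∀ {x} → (∀ e → x e ≡ false) → InSpan z x
    InSpan-null x≡0 = (λ _ → false) , λ {e} _ →
      trans (null (ω-linearˡ (fundamental e)) x≡0) (sym (sum-zero {r} λ _ → refl))

    InSpan-combine : ∀ {k} (b : Fin k → Bool) (y : Fin k → Chain) →
                     (∀ i → b i ≡ true → InSpan z (y i)) → InSpan z (combine b y)
    InSpan-combine {zero}  b y h = InSpan-null λ _ → refl
    InSpan-combine {suc k} b y h = InSpan-⊕ first (InSpan-combine (b ∘ suc) (y ∘ suc) (h ∘ suc))
      where
      first : InSpan z (λ e → b zero ∧ y zero e)
      first with b zero in eq
      ... | false = InSpan-null λ _ → refl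
      ... | true  = h zero eq

    -- The path of each vertex enters as often as the degree of that vertex in `x`, which is even;
    -- only the edges of `x` survive.
    cycle-decomposition : ∀ {x} → Cycle x → combine x fundamental ≗ x
    cycle-decomposition {x} cx e = begin
      sum (λ f → x f ∧ ((f ==ᶠ e) xor δ κ f))                  ≡⟨ sum-cong (λ f → ∧-xor (x f) (f ==ᶠ e) (δ κ f)) ⟩
      sum (λ f → (x f ∧ (f ==ᶠ e)) xor (x f ∧ δ κ f))          ≡⟨ sum-xor (λ f → x f ∧ (f ==ᶠ e)) (λ f → x f ∧ δ κ f) ⟩
      sum (λ f → x f ∧ (f ==ᶠ e)) xor ⟨ x , δ κ ⟩              ≡⟨ cong₂ _xor_ (sum-δʳ e x) (stokes κ x) ⟩
      x e xor ⟨ κ , bd x ⟩                                     ≡⟨ cong (x e xor_) (sum-zero λ v → trans (cong (κ v ∧_) (cx v)) (∧-zeroʳ (κ v))) ⟩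
      x e xor false                                            ≡⟨ xor-identityʳ (x e) ⟩
      x e                                                      ∎
      where
      κ : Fin n → Bool
      κ v = path v e

    InSpan⇒∃ : ∀ {x} → InSpan z x → ∃ λ (c : Fin r → Bool) →
      ∀ {e} → ES e ≡ true → ω (x ⊕ combine c z) (fundamental e) ≡ false
    InSpan⇒∃ {x} (c , eq) = c , λ {e} pe → begin
      ω (x ⊕ combine c z) (fundamental e)                     ≡⟨ add (ω-linearˡ (fundamental e)) x (combine c z) ⟩
      ω x (fundamental e) xor ω (combine c z) (fundamental e)
        ≡⟨ ≡⇒xor≡false (trans (eq pe) (sym (combination (ω-linearˡ (fundamental e)) c z))) ⟩
      false                                                   ∎

    fundamental⇒Spanning : (∀ {e} → ES e ≡ true → InSpan z (fundamental e)) → Spanning z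
    fundamental⇒Spanning h x sx cx =
      InSpan⇒∃ (InSpan-resp (cycle-decomposition cx) (InSpan-combine x fundamental present))
      where
      present : ∀ e → x e ≡ true → InSpan z (fundamental e)
      present e xe with ES e in pe
      ... | true  = h pe
      ... | false = contradiction (trans (sym xe) (sx e pe)) λ ()

-- Alternating forms over 𝔽₂

module Symplectic {I : Set} {enum : List I} (complete : ∀ i → i ∈ enum) where

  Form : Set
  Form = I → I → Bool

  FormNondegenerate : ∀ {r} → Form → (Fin r → I) → Set
  FormNondegenerate {r} B z = ∀ (c : Fin r → Bool) → (∀ j → sum (λ l → c l ∧ B (z l) (z j)) ≡ false) → ∀ l → c l ≡ false

  FormSpanning : ∀ {r} → Form → (Fin r → I) → Set
  FormSpanning {r} B z = ∀ i → ∃ λ (c : Fin r → Bool) → ∀ j → B i j ≡ sum (λ l → c l ∧ B (z l) j)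

  search : ∀ (B : Form) → (∃ λ i → ∃ λ j → B i j ≡ true) ⊎ (∀ i j → B i j ≡ false)
  search B with Any.any? (λ i → Any.any? (λ j → B i j BoolP.≟ true) enum) enum
  ... | yes p = let i , q = Any.satisfied p in inj₁ (i , Any.satisfied q)
  ... | no ¬p = inj₂ λ i j → BoolP.¬-not λ Bij →
                  ¬p (lose (complete i) (lose (complete j) Bij))

  adjoin : ∀ {r} → I → I → (Fin r → I) → Fin (suc (suc r)) → I
  adjoin i j z zero          = i
  adjoin i j z (suc zero)    = j
  adjoin i j z (suc (suc l)) = z l

  -- B⊥ x y = B (π x) (π y) for the orthogonal projection π x = x + B(x,j) i + B(x,i) j onto the complement of i and j
  module Complement (B : Form) (B-sym : ∀ x y → B x y ≡ B y x) (B-alt : ∀ x → B x x ≡ false)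
                    {i j : I} (Bij : B i j ≡ true) where

    B⊥ : Form
    B⊥ x y = B x y xor ((B x i ∧ B j y) xor (B x j ∧ B i y))

    B⊥-sym : ∀ x y → B⊥ x y ≡ B⊥ y x
    B⊥-sym x y rewrite B-sym x y | B-sym x i | B-sym x j | B-sym y i | B-sym y j =
      solve 5 (λ p a b c d → p :+ ((a :* b) :+ (c :* d)) := p :+ ((d :* c) :+ (b :* a))) refl
        (B y x) (B i x) (B j y) (B j x) (B i y)
      where open xor-∧-Solver

    B⊥-alt : ∀ x → B⊥ x x ≡ false
    B⊥-alt x rewrite B-alt x | B-sym x i | B-sym x j =
      solve 2 (λ a b → (a :* b) :+ (b :* a) := con false) refl (B i x) (B j x)
      where open xor-∧-Solver

    module _ {r : ℕ} (z : Fin r → I) (c : Fin r → Bool) where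

      row : I → Bool
      row y = sum (λ l → c l ∧ B (z l) y)

      row⊥ : ∀ y → sum (λ l → c l ∧ B⊥ (z l) y) ≡ row y xor ((row i ∧ B j y) xor (row j ∧ B i y))
      row⊥ y = begin
        sum (λ l → c l ∧ B⊥ (z l) y)
          ≡⟨ sum-cong (λ l → expand (c l) (B (z l) y) (B (z l) i) (B j y) (B (z l) j) (B i y)) ⟩
        sum (λ l → (c l ∧ B (z l) y) xor (((c l ∧ B (z l) i) ∧ B j y) xor ((c l ∧ B (z l) j) ∧ B i y)))
          ≡⟨ sum-xor (λ l → c l ∧ B (z l) y) (λ l → ((c l ∧ B (z l) i) ∧ B j y) xor ((c l ∧ B (z l) j) ∧ B i y)) ⟩
        row y xor sum (λ l → ((c l ∧ B (z l) i) ∧ B j y) xor ((c l ∧ B (z l) j) ∧ B i y))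
          ≡⟨ cong (row y xor_) (trans
               (sum-xor (λ l → (c l ∧ B (z l) i) ∧ B j y) (λ l → (c l ∧ B (z l) j) ∧ B i y))
               (sym (cong₂ _xor_ (*-distribʳ-sum (B j y) (λ l → c l ∧ B (z l) i))
                                 (*-distribʳ-sum (B i y) (λ l → c l ∧ B (z l) j))))) ⟩
        row y xor ((row i ∧ B j y) xor (row j ∧ B i y)) ∎
        where
        expand : ∀ c p q s t u → c ∧ (p xor ((q ∧ s) xor (t ∧ u))) ≡ (c ∧ p) xor (((c ∧ q) ∧ s) xor ((c ∧ t) ∧ u))
        expand = solve 6 (λ c p q s t u → c :* (p :+ ((q :* s) :+ (t :* u))) := (c :* p) :+ (((c :* q) :* s) :+ ((c :* t) :* u))) refl
          where open xor-∧-Solver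

    -- Testing against `j` and `i` expresses the coefficients of `i` and `j` through those of `z`.
    -- Substituting them turns the remaining tests for `B` into tests for `B⊥`, so the coefficients
    -- of `z` vanish, and with them the other two.
    adjoin-nondegenerate : ∀ {r} {z : Fin r → I} → FormNondegenerate B⊥ z → FormNondegenerate B (adjoin i j z)
    adjoin-nondegenerate {r} {z} nd c c⊥ = all≡0
      where
      a b : Bool
      a = c zero
      b = c (suc zero)
      c' : Fin r → Bool
      c' l = c (suc (suc l))
      a≡ : row z c' j ≡ a
      a≡ = sym (xor≡false⇒≡ (begin
        a xor row z c' j                                        ≡⟨ cong₂ _xor_ (∧-identityʳ a) (cong (_xor row z c' j) (∧-zeroʳ b)) ⟨
        (a ∧ true) xor ((b ∧ false) xor row z c' j)             ≡⟨ cong₂ (λ p q → (a ∧ p) xor ((b ∧ q) xor row z c' j)) Bij (B-alt j) ⟨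
        (a ∧ B i j) xor ((b ∧ B j j) xor row z c' j)            ≡⟨ c⊥ (suc zero) ⟩
        false                                                   ∎))
      b≡ : row z c' i ≡ b
      b≡ = sym (xor≡false⇒≡ (begin
        b xor row z c' i                                        ≡⟨ cong₂ _xor_ (∧-zeroʳ a) (cong (_xor row z c' i) (∧-identityʳ b)) ⟨
        (a ∧ false) xor ((b ∧ true) xor row z c' i)             ≡⟨ cong₂ (λ p q → (a ∧ p) xor ((b ∧ q) xor row z c' i)) (B-alt i) (trans (B-sym j i) Bij) ⟨
        (a ∧ B i i) xor ((b ∧ B j i) xor row z c' i)            ≡⟨ c⊥ zero ⟩
        false                                                   ∎))
      c'≡0 : ∀ l → c' l ≡ false
      c'≡0 = nd c' λ l → begin
        sum (λ k → c' k ∧ B⊥ (z k) (z l))                       ≡⟨ row⊥ z c' (z l) ⟩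
        row z c' (z l) xor ((row z c' i ∧ B j (z l)) xor (row z c' j ∧ B i (z l)))
          ≡⟨ cong₂ (λ p q → row z c' (z l) xor ((p ∧ B j (z l)) xor (q ∧ B i (z l)))) b≡ a≡ ⟩
        row z c' (z l) xor ((b ∧ B j (z l)) xor (a ∧ B i (z l)))
          ≡⟨ swap (row z c' (z l)) (b ∧ B j (z l)) (a ∧ B i (z l)) ⟩
        (a ∧ B i (z l)) xor ((b ∧ B j (z l)) xor row z c' (z l)) ≡⟨ c⊥ (suc (suc l)) ⟩
        false                                                   ∎
        where
        swap : ∀ p q s → p xor (q xor s) ≡ s xor (q xor p)
        swap = solve 3 (λ p q s → p :+ (q :+ s) := s :+ (q :+ p)) refl where open xor-∧-Solver
      row≡0 : ∀ y → row z c' y ≡ false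
      row≡0 y = sum-zero λ l → cong (_∧ B (z l) y) (c'≡0 l)
      all≡0 : ∀ l → c l ≡ false
      all≡0 zero          = trans (sym a≡) (row≡0 j)
      all≡0 (suc zero)    = trans (sym b≡) (row≡0 i)
      all≡0 (suc (suc l)) = c'≡0 l

    -- Modulo the radical of `B`, the projection of `x` is a combination of the projections of the
    -- `z`. Undoing the projections adds multiples of `i` and `j`, which collect the correction
    -- terms of `x` and of the `z`.
    adjoin-spanning : ∀ {r} {z : Fin r → I} → FormSpanning B⊥ z → FormSpanning B (adjoin i j z)
    adjoin-spanning {r} {z} span x with span x
    ... | c' , eq = c , λ y → begin
      B x y
        ≡⟨ cancel (B x y) ((B x i ∧ B j y) xor (B x j ∧ B i y)) ⟨
      B⊥ x y xor ((B x i ∧ B j y) xor (B x j ∧ B i y))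
        ≡⟨ cong (_xor ((B x i ∧ B j y) xor (B x j ∧ B i y))) (trans (eq y) (row⊥ z c' y)) ⟩
      (row z c' y xor ((row z c' i ∧ B j y) xor (row z c' j ∧ B i y))) xor ((B x i ∧ B j y) xor (B x j ∧ B i y))
        ≡⟨ collect (row z c' y) (row z c' i) (B j y) (row z c' j) (B i y) (B x i) (B x j) ⟩
      ((B x j xor row z c' j) ∧ B i y) xor (((B x i xor row z c' i) ∧ B j y) xor row z c' y) ∎
      where
      c : Fin (suc (suc r)) → Bool
      c zero          = B x j xor row z c' j
      c (suc zero)    = B x i xor row z c' i
      c (suc (suc l)) = c' l
      cancel : ∀ p q → (p xor q) xor q ≡ p
      cancel = solve 2 (λ p q → (p :+ q) :+ q := p) refl where open xor-∧-Solver
      collect : ∀ w p q s t u v → (w xor ((p ∧ q) xor (s ∧ t))) xor ((u ∧ q) xor (v ∧ t))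
                                ≡ ((v xor s) ∧ t) xor (((u xor p) ∧ q) xor w)
      collect = solve 7 (λ w p q s t u v → (w :+ ((p :* q) :+ (s :* t))) :+ ((u :* q) :+ (v :* t))
                                        := ((v :+ s) :* t) :+ (((u :+ p) :* q) :+ w)) refl
        where open xor-∧-Solver

  -- Hyperbolic pairs are split off until there are `t` of them or the remaining form vanishes; in
  -- the latter case the pairs found so far span. The size `t * 2` unfolds to the two successors
  -- that `adjoin` produces.
  select : ∀ t (B : Form) → (∀ x y → B x y ≡ B y x) → (∀ x → B x x ≡ false) →
    (∃ λ (z : Fin (t * 2) → I) → FormNondegenerate B z) ⊎
    (∃ λ s → s < t × ∃ λ (z : Fin (s * 2) → I) → FormSpanning B z)
  select zero    B B-sym B-alt = inj₁ ((λ ()) , λ c _ ())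
  select (suc t) B B-sym B-alt with search B
  ... | inj₂ B≡0 = inj₂ (0 , s≤s z≤n , (λ ()) , λ i → (λ ()) , B≡0 i)
  ... | inj₁ (i , j , Bij) = Sum.map
      (λ (z , nd) → adjoin i j z , C.adjoin-nondegenerate nd)
      (λ (s , s<t , z , span) → suc s , s≤s s<t , adjoin i j z , C.adjoin-spanning span)
      (select t C.B⊥ C.B⊥-sym C.B⊥-alt)
    where module C = Complement B B-sym B-alt Bij

-- Reachability and components

module Reach {n m : ℕ} (G : EmbeddedGraph n m) where
  open EmbeddedGraph G
  open Homology G

  opposite : Dart m → Dart m
  opposite (e , b) = (e , not b)

  module _ {VS : Fin n → Bool} {ES : Fin m → Bool} where

    private
      R : ℕ → Fin n → Fin n → Bool
      R = reach G VS ES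

      hop : ℕ → Fin n → Fin n → Fin m → Bool
      hop k u v e = ES e ∧ ((R k u (src e) ∧ (tgt e ==ᶠ v)) ∨ (R k u (tgt e) ∧ (src e ==ᶠ v)))

    Hop : ℕ → Fin n → Fin n → Set
    Hop k u v = ∃ λ d → T (ES (proj₁ d)) × T (reach G VS ES k u (end d)) × end (opposite d) ≡ v

    reach-suc⁻ : ∀ k {u v} → T (reach G VS ES (suc k) u v) → T (reach G VS ES k u v) ⊎ Hop k u v
    reach-suc⁻ k {u} {v} t with Equivalence.to (T-∨ {R k u v}) t
    ... | inj₁ s = inj₁ s
    ... | inj₂ s with Any.satisfied (AnyP.any⁻ (hop k u v) (allFin m) s)
    ...   | e , p with Equivalence.to (T-∧ {ES e}) p
    ...     | pe , q with Equivalence.to (T-∨ {R k u (src e) ∧ (tgt e ==ᶠ v)}) q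
    ...       | inj₁ q' = let x , y = Equivalence.to (T-∧ {R k u (src e)}) q' in inj₂ ((e , false) , pe , x , ==ᶠ⇒≡ y)
    ...       | inj₂ q' = let x , y = Equivalence.to (T-∧ {R k u (tgt e)}) q' in inj₂ ((e , true) , pe , x , ==ᶠ⇒≡ y)

    reach-weaken : ∀ k {u v} → T (reach G VS ES k u v) → T (reach G VS ES (suc k) u v)
    reach-weaken k {u} {v} t = Equivalence.from (T-∨ {R k u v}) (inj₁ t)

    reach-hop : ∀ k {u v} → Hop k u v → T (reach G VS ES (suc k) u v)
    reach-hop k {u} {v} ((e , b) , pe , x , y) = Equivalence.from (T-∨ {R k u v}) (inj₂
      (AnyP.any⁺ (hop k u v) (lose (∈-allFin e) (Equivalence.from (T-∧ {ES e}) (pe , side b x y)))))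
      where
      side : ∀ b → T (R k u (end (e , b))) → end (opposite (e , b)) ≡ v →
             T ((R k u (src e) ∧ (tgt e ==ᶠ v)) ∨ (R k u (tgt e) ∧ (src e ==ᶠ v)))
      side false x y = Equivalence.from (T-∨ {R k u (src e) ∧ (tgt e ==ᶠ v)})
        (inj₁ (Equivalence.from (T-∧ {R k u (src e)}) (x , ≡⇒==ᶠ y)))
      side true x y = Equivalence.from (T-∨ {R k u (src e) ∧ (tgt e ==ᶠ v)})
        (inj₂ (Equivalence.from (T-∧ {R k u (tgt e)}) (x , ≡⇒==ᶠ y)))

    reach-≤ : ∀ {j k u v} → j ≤ k → T (reach G VS ES j u v) → T (reach G VS ES k u v)
    reach-≤ {zero}  {zero}  z≤n t = t
    reach-≤ {j}     {suc k} j≤ t with ℕP.m≤n⇒m<n∨m≡n j≤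
    ... | inj₁ (s≤s j≤k) = reach-weaken k (reach-≤ j≤k t)
    ... | inj₂ refl      = t

    reach-trans : ∀ {j} k {u v w} → T (reach G VS ES j u v) → T (reach G VS ES k v w) → T (reach G VS ES (k + j) u w)
    reach-trans zero s t with ==ᶠ⇒≡ t
    ... | refl = s
    reach-trans {j} (suc k) s t with reach-suc⁻ k t
    ... | inj₁ t'               = reach-weaken (k + j) (reach-trans k s t')
    ... | inj₂ (d , pe , x , y) = reach-hop (k + j) (d , pe , reach-trans k s x , y)

    module _ (u : Fin n) where

      Stable : ℕ → Set
      Stable j = ∀ v → T (R (suc j) u v) → T (R j u v)

      stable⇒ : ∀ {j} → Stable j → ∀ k {v} → T (R k u v) → T (R j u v)
      stable⇒ {j} st zero t = reach-≤ {0} {j} z≤n t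
      stable⇒ {j} st (suc k) t with reach-suc⁻ k t
      ... | inj₁ t'               = stable⇒ {j} st k t'
      ... | inj₂ (d , pe , x , y) = st _ (reach-hop j (d , pe , stable⇒ {j} st k x , y))

      -- otherwise each of the steps 0,…,n reaches a new vertex
      stabilises : ∃ λ j → j ≤ n × Stable j
      stabilises with FinP.any? {suc n} (λ j → FinP.all? λ v → T? (R (suc (toℕ j)) u v) →-dec T? (R (toℕ j) u v))
      ... | yes (j , st) = toℕ j , ℕP.≤-pred (FinP.toℕ<n j) , st
      ... | no ¬st = ⊥-elim clash
        where
        step? : ∀ j v → Dec (T (R (suc j) u v) → T (R j u v))
        step? j v = T? (R (suc j) u v) →-dec T? (R j u v)

        new : (j : Fin (suc n)) → ∃ λ v → ¬ (T (R (suc (toℕ j)) u v) → T (R (toℕ j) u v))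
        new j = FinP.¬∀⟶∃¬ n _ (step? (toℕ j)) (λ st → ¬st (j , st))

        clash : ⊥
        clash with FinP.pigeonhole (ℕP.n<1+n n) (λ j → proj₁ (new j))
        ... | i , j , i<j , eq with T? (R (suc (toℕ i)) u (proj₁ (new i)))
        ...   | yes t = proj₂ (new j) λ _ → subst (λ v → T (R (toℕ j) u v)) eq (reach-≤ {suc (toℕ i)} {toℕ j} i<j t)
        ...   | no ¬t = proj₂ (new i) λ t → contradiction t ¬t

    -- `connected` admits only n steps, while concatenated walks are longer. The set reached from
    -- `u` no longer grows after some step up to n, so nothing is lost.
    reach⇒connected : ∀ k {u v} → T (reach G VS ES k u v) → T (connected G VS ES u v)
    reach⇒connected k {u} t = let j , j≤n , st = stabilises u in reach-≤ j≤n (stable⇒ u {j} st k t)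

  reach-mono : ∀ {VS VS' : Fin n → Bool} {ES ES' : Fin m → Bool} → (∀ {e} → T (ES e) → T (ES' e)) →
               ∀ k {u v} → T (reach G VS ES k u v) → T (reach G VS' ES' k u v)
  reach-mono sub zero t = t
  reach-mono {VS} {VS'} {ES} {ES'} sub (suc k) t with reach-suc⁻ {VS} {ES} k t
  ... | inj₁ t'               = reach-weaken {VS'} {ES'} k (reach-mono {VS} {VS'} {ES} {ES'} sub k t')
  ... | inj₂ (d , pe , x , y) = reach-hop {VS'} {ES'} k (d , sub pe , reach-mono {VS} {VS'} {ES} {ES'} sub k x , y)

  -- The walk as a chain modulo 2: the boundary of each added edge replaces the old end of the walk
  -- by the new one.
  reach⇒chain : ∀ {VS : Fin n → Bool} {ES : Fin m → Bool} k {u v} → T (reach G VS ES k u v) →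
    ∃ λ (p : Chain) → (∀ e → ES e ≡ false → p e ≡ false) × (∀ w → bd p w ≡ (u ==ᶠ w) xor (v ==ᶠ w))
  reach⇒chain zero {u} t with ==ᶠ⇒≡ t
  ... | refl = (λ _ → false) , (λ _ _ → refl) , λ w →
    trans (sum-zero {m} λ _ → refl) (sym (xor-same (u ==ᶠ w)))
  reach⇒chain {VS} {ES} (suc k) {u} {v} t with reach-suc⁻ {VS} {ES} k t
  ... | inj₁ t' = reach⇒chain {VS} {ES} k t'
  ... | inj₂ ((e , b) , pe , x , y) with reach⇒chain {VS} {ES} k x
  ...   | p , p-supp , p-bd = p ⊕ (e ==ᶠ_) , supp , λ w → begin
      bd (p ⊕ (e ==ᶠ_)) w
        ≡⟨ add (bd-linear w) p (e ==ᶠ_) ⟩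
      bd p w xor bd (e ==ᶠ_) w
        ≡⟨ cong₂ _xor_ (p-bd w) (sum-δ e (λ f → (src f ==ᶠ w) xor (tgt f ==ᶠ w))) ⟩
      ((u ==ᶠ w) xor (end (e , b) ==ᶠ w)) xor ((src e ==ᶠ w) xor (tgt e ==ᶠ w))
        ≡⟨ telescope b w ⟩
      (u ==ᶠ w) xor (end (e , not b) ==ᶠ w)
        ≡⟨ cong (λ v → (u ==ᶠ w) xor (v ==ᶠ w)) y ⟩
      (u ==ᶠ w) xor (v ==ᶠ w) ∎
    where
    supp : ∀ f → ES f ≡ false → p f xor (e ==ᶠ f) ≡ false
    supp f pf with e ==ᶠ f in eq
    ... | false = trans (xor-identityʳ (p f)) (p-supp f pf)
    ... | true  = contradiction (trans (sym (T⇒≡ pe)) (trans (cong ES (==ᶠ⇒≡ (≡⇒T eq))) pf)) λ ()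
    telescope : ∀ b w → ((u ==ᶠ w) xor (end (e , b) ==ᶠ w)) xor ((src e ==ᶠ w) xor (tgt e ==ᶠ w))
                      ≡ (u ==ᶠ w) xor (end (e , not b) ==ᶠ w)
    telescope false w = solve 3 (λ u s t → (u :+ s) :+ (s :+ t) := u :+ t) refl (u ==ᶠ w) (src e ==ᶠ w) (tgt e ==ᶠ w)
      where open xor-∧-Solver
    telescope true w = solve 3 (λ u s t → (u :+ t) :+ (s :+ t) := u :+ s) refl (u ==ᶠ w) (src e ==ᶠ w) (tgt e ==ᶠ w)
      where open xor-∧-Solver

module Components {n m : ℕ} (G : EmbeddedGraph n m) (VS : Fin n → Bool) (ES : Fin m → Bool) where

  components : List (Fin n)
  components = filterᵇ (compRep G VS ES) (allFin n)

  least : ∀ N v → toℕ v ≤ N → VS v ≡ true → ∃ λ u → VS u ≡ true × (∀ w → VS w ≡ true → toℕ u ≤ toℕ w)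
  least N v v≤N v∈ with FinP.any? (λ w → (VS w BoolP.≟ true) ×-dec (toℕ w ℕ.<? toℕ v))
  ... | no ¬smaller = v , v∈ , λ w w∈ → ℕP.≮⇒≥ λ w<v → ¬smaller (w , w∈ , w<v)
  least zero    v v≤N v∈ | yes (w , w∈ , w<v) = contradiction (ℕP.≤-trans w<v v≤N) λ ()
  least (suc N) v v≤N v∈ | yes (w , w∈ , w<v) = least N w (ℕP.≤-pred (ℕP.≤-trans w<v v≤N)) w∈

  -- The least vertex of the whole vertex set is also least in its component, hence a
  -- representative.
  component-exists : ∀ {v} → VS v ≡ true → 1 ≤ numComponents G VS ES
  component-exists {v} v∈ with least (toℕ v) v ℕP.≤-refl v∈
  ... | u , u∈ , min = nonempty (∈-filter⁺ (T? ∘ compRep G VS ES) (∈-allFin u)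
        (Equivalence.from T-∧ (≡⇒T u∈ , AllP.all⁻ _ (All.universal below (allFin n)))))
    where
    nonempty : ∀ {xs : List (Fin n)} {x} → x ∈ xs → 1 ≤ length xs
    nonempty (here _)  = s≤s z≤n
    nonempty (there _) = s≤s z≤n
    below : ∀ w → T (not (VS w ∧ connected G VS ES w u) ∨ (toℕ u ℕ.≤ᵇ toℕ w))
    below w with VS w in w∈
    ... | false = _
    ... | true with connected G VS ES w u
    ...   | false = _
    ...   | true  = ℕP.≤⇒≤ᵇ (min w w∈)

  component-unique : (∀ {u v} → VS u ≡ true → VS v ≡ true → T (connected G VS ES u v)) → numComponents G VS ES ≤ 1
  component-unique conn = atMostOne (UniqueP.filter⁺ (T? ∘ compRep G VS ES) (UniqueP.allFin⁺ n))
    λ u∈ v∈ → FinP.toℕ-injective (ℕP.≤-antisym (below u∈ v∈) (below v∈ u∈))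
    where
    atMostOne : ∀ {xs : List (Fin n)} → Unique xs → (∀ {x y} → x ∈ xs → y ∈ xs → x ≡ y) → length xs ≤ 1
    atMostOne {[]}         _ same = z≤n
    atMostOne {_ ∷ []}     _ same = s≤s z≤n
    atMostOne {_ ∷ _ ∷ _} ((x≢y ∷ _) ∷ _) same = contradiction (same (here refl) (there (here refl))) x≢y
    below : ∀ {u v} → u ∈ components → v ∈ components → toℕ u ≤ toℕ v
    below {u} {v} u∈ v∈ with Equivalence.to (T-∧ {VS u}) (proj₂ (∈-filter⁻ (T? ∘ compRep G VS ES) {xs = allFin n} u∈))
                           | Equivalence.to (T-∧ {VS v}) (proj₂ (∈-filter⁻ (T? ∘ compRep G VS ES) {xs = allFin n} v∈))
    ... | uVS , minimal | vVS , _ = extract (≡⇒T (cong₂ _∧_ (T⇒≡ vVS) (T⇒≡ (conn (T⇒≡ vVS) (T⇒≡ uVS)))))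
            (All.lookup (AllP.all⁺ _ (allFin n) minimal) (∈-allFin v))
      where
      extract : ∀ {c} → T c → T (not c ∨ (toℕ u ℕ.≤ᵇ toℕ v)) → toℕ u ≤ toℕ v
      extract {true} _ t = ℕP.≤ᵇ⇒≤ _ _ t

-- Clusters

-- The list may repeat entries. A function on the listed set is determined by its values along
-- `lookup`, so the counting principle for injections applies again.
count≤length : ∀ {k} (L : List (Fin k)) → count (λ i → any (_==ᶠ i) L) ≤ length L
count≤length {k} L = subst (count S ≤_) (ListP.length-tabulate {n = length L} id)
  (injection⇒≤ Fin._≟_ {filterᵇ S (allFin k)} {allFin (length L)}
    (UniqueP.filter⁺ (T? ∘ S) (UniqueP.allFin⁺ k)) (λ u j → u (lookup L j)) λ u u' same i∈ →
      let j∈ = Any.map ==ᶠ⇒≡ (AnyP.any⁻ _ L (proj₂ (∈-filter⁻ (T? ∘ S) {xs = allFin k} i∈)))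
      in subst (λ i → u i ≡ u' i) (AnyP.lookup-index j∈) (same (∈-allFin (Any.index j∈))))
  where
  S : Fin k → Bool
  S i = any (_==ᶠ i) L

-- Generating cycles of a cluster

module ClusterCycles {n m k : ℕ} {G : EmbeddedGraph n m} (H : Cluster G k) where
  open EmbeddedGraph G
  open Cluster H
  open Homology G
  open Reach G

  a : Fin k
  a = proj₁ anchor

  cross : Fin k → Fin n
  cross i = proj₁ (proj₂ anchor i)

  cross∈anchor : ∀ i → T (mem a (cross i))
  cross∈anchor i = proj₁ (proj₂ (proj₂ anchor i))

  cross∈ : ∀ i → T (mem i (cross i))
  cross∈ i = proj₂ (proj₂ (proj₂ anchor i))

  root : Fin n
  root = cross a

  in? : Fin k → Fin m → Bool
  in? i e = ⌊ lab e Fin.≟ i ⌋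

  in?-≢ : ∀ {i e} → lab e ≢ i → in? i e ≡ false
  in?-≢ {i} {e} ne with lab e Fin.≟ i
  ... | yes eq = contradiction eq ne
  ... | no  _  = refl

  mem-end : ∀ d → mem (lab (proj₁ d)) (end d) ≡ true
  mem-end (e , false) = T⇒≡ (proj₁ (ends-mem e))
  mem-end (e , true)  = T⇒≡ (proj₂ (ends-mem e))

  private
    -- A route from the root through the anchor to its crossing with member `i`, and on inside that
    -- member to `v`. It uses edges of these two graphs only, which is what bounds the number of
    -- members per generator.
    Arm : Fin k → Fin n → Set
    Arm i v = ∃ λ (p : Chain) →
      (∀ e → lab e ≢ a → lab e ≢ i → p e ≡ false) ×
      (mem i v ≡ true → ∀ w → bd p w ≡ (v ==ᶠ w) xor (root ==ᶠ w))

    makeArm : ∀ i v → Arm i v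
    makeArm i v with mem i v in v∈
    ... | false = (λ _ → false) , (λ _ _ _ → refl) , λ ()
    ... | true
      with reach⇒chain {mem a} {in? a} n (conn a root (cross i) (cross∈anchor a) (cross∈anchor i))
         | reach⇒chain {mem i} {in? i} n (conn i (cross i) v (cross∈ i) (≡⇒T v∈))
    ...   | p , p-supp , p-bd | q , q-supp , q-bd = p ⊕ q ,
            (λ e ≢a ≢i → cong₂ _xor_ (p-supp e (in?-≢ ≢a)) (q-supp e (in?-≢ ≢i))) ,
            λ _ w → begin
              bd (p ⊕ q) w                ≡⟨ add (bd-linear w) p q ⟩
              bd p w xor bd q w           ≡⟨ cong₂ _xor_ (p-bd w) (q-bd w) ⟩
              ((root ==ᶠ w) xor (cross i ==ᶠ w)) xor ((cross i ==ᶠ w) xor (v ==ᶠ w))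
                ≡⟨ telescope (root ==ᶠ w) (cross i ==ᶠ w) (v ==ᶠ w) ⟩
              (v ==ᶠ w) xor (root ==ᶠ w)  ∎
      where
      telescope : ∀ r c v → (r xor c) xor (c xor v) ≡ v xor r
      telescope = solve 3 (λ r c v → (r :+ c) :+ (c :+ v) := v :+ r) refl where open xor-∧-Solver

  arm : Fin k → Fin n → Chain
  arm i v = proj₁ (makeArm i v)

  arm-supp : ∀ i v e → lab e ≢ a → lab e ≢ i → arm i v e ≡ false
  arm-supp i v = proj₁ (proj₂ (makeArm i v))

  arm-bd : ∀ {i v} → mem i v ≡ true → ∀ w → bd (arm i v) w ≡ (v ==ᶠ w) xor (root ==ᶠ w)
  arm-bd {i} {v} = proj₂ (proj₂ (makeArm i v))

  module Sub (S : Fin k → Bool) (a∈S : S a ≡ true) where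

    VS : Fin n → Bool
    VS = unionV H S

    ES : Fin m → Bool
    ES = unionE H S

    ∈-union : ∀ {i v} → S i ≡ true → mem i v ≡ true → VS v ≡ true
    ∈-union {i} i∈S v∈ = T⇒≡ (AnyP.any⁺ _ (lose (∈-allFin i) (≡⇒T (cong₂ _∧_ i∈S v∈))))

    private
      -- A member of `S` containing `v`. The anchor is the default outside the union, so that the
      -- support condition on paths holds at every vertex.
      pick : ∀ v → ∃ λ i → S i ≡ true × (VS v ≡ true → mem i v ≡ true)
      pick v with VS v in eq
      ... | false = a , a∈S , λ ()
      ... | true with Any.satisfied (AnyP.any⁻ (λ i → S i ∧ mem i v) (allFin k) (≡⇒T eq))
      ...   | i , t = let x , y = Equivalence.to (T-∧ {S i}) t in i , T⇒≡ x , λ _ → T⇒≡ y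

    owner : Fin n → Fin k
    owner v = proj₁ (pick v)

    owner∈S : ∀ v → S (owner v) ≡ true
    owner∈S v = proj₁ (proj₂ (pick v))

    mem-owner : ∀ {v} → VS v ≡ true → mem (owner v) v ≡ true
    mem-owner {v} = proj₂ (proj₂ (pick v))

    outside : ∀ {e i} → S i ≡ true → ES e ≡ false → lab e ≢ i
    outside i∈S pe refl = contradiction (trans (sym i∈S) pe) λ ()

    rooted : Rooted G VS ES
    rooted = record
      { base      = root
      ; base∈     = ∈-union a∈S (T⇒≡ (cross∈anchor a))
      ; end∈      = λ {d} pd → ∈-union pd (mem-end d)
      ; path      = λ v → arm (owner v) v
      ; path-supp = λ v e pe → arm-supp (owner v) v e (outside a∈S pe) (outside (owner∈S v) pe)
      ; path-bd   = λ v∈ → arm-bd (mem-owner v∈)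
      }

    union-connected : ∀ {u v} → VS u ≡ true → VS v ≡ true → T (connected G VS ES u v)
    -- Three walks of at most n steps each: from `u` to the crossing of its owner, through the
    -- anchor to the crossing of the other owner, and on to `v`.
    union-connected {u} {v} u∈ v∈ = reach⇒connected {VS} {ES} (n + (n + n))
      (reach-trans {VS} {ES} n (reach-trans {VS} {ES} n
        (walk (owner∈S u) (≡⇒T (mem-owner u∈)) (cross∈ (owner u)))
        (walk a∈S (cross∈anchor (owner u)) (cross∈anchor (owner v))))
        (walk (owner∈S v) (cross∈ (owner v)) (≡⇒T (mem-owner v∈))))
      where
      walk : ∀ {i x y} → S i ≡ true → T (mem i x) → T (mem i y) → T (reach G VS ES n x y)
      walk {i} {x} {y} i∈S x∈ y∈ = reach-mono {mem i} {VS} {in? i} {ES} included n (conn i x y x∈ y∈)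
        where
        included : ∀ {e} → T (in? i e) → T (ES e)
        included {e} t rewrite ==ᶠ⇒≡ {a = lab e} {i} t = ≡⇒T i∈S

  module Whole = Sub (λ _ → true) refl

  Generator : Set
  Generator = Fin m ⊎ Dart m

  -- each lies in the union of the anchor and at most two further graphs; together they generate all cycles
  cycle : Generator → Chain
  cycle (inj₁ e) = (e ==ᶠ_) ⊕ (arm (lab e) (src e) ⊕ arm (lab e) (tgt e))
  cycle (inj₂ d) = arm (lab (proj₁ d)) (end d) ⊕ arm (Whole.owner (end d)) (end d)

  -- Besides the anchor, the cycle uses edges of these members only. An edge generator needs one of
  -- them, which is listed twice for uniformity.
  label₁ label₂ : Generator → Fin k
  label₁ (inj₁ e) = lab e
  label₁ (inj₂ d) = lab (proj₁ d)
  label₂ (inj₁ e) = lab e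
  label₂ (inj₂ d) = Whole.owner (end d)

  cycle-supp : ∀ γ e → lab e ≢ a → lab e ≢ label₁ γ → lab e ≢ label₂ γ → cycle γ e ≡ false
  cycle-supp (inj₁ f) e ≢a ≢₁ _
    rewrite arm-supp (lab f) (src f) e ≢a ≢₁ | arm-supp (lab f) (tgt f) e ≢a ≢₁ with f ==ᶠ e in eq
  ... | false = refl
  ... | true  = contradiction (cong lab (sym (==ᶠ⇒≡ (≡⇒T eq)))) ≢₁
  cycle-supp (inj₂ d) e ≢a ≢₁ ≢₂ = cong₂ _xor_ (arm-supp _ (end d) e ≢a ≢₁) (arm-supp _ (end d) e ≢a ≢₂)

  cycle-Cycle : ∀ γ → Cycle (cycle γ)
  cycle-Cycle (inj₁ e) w = begin
    bd (cycle (inj₁ e)) w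
      ≡⟨ add (bd-linear w) (e ==ᶠ_) (arm (lab e) (src e) ⊕ arm (lab e) (tgt e)) ⟩
    bd (e ==ᶠ_) w xor bd (arm (lab e) (src e) ⊕ arm (lab e) (tgt e)) w
      ≡⟨ cong₂ _xor_ (sum-δ e (λ f → (src f ==ᶠ w) xor (tgt f ==ᶠ w)))
           (trans (add (bd-linear w) (arm (lab e) (src e)) (arm (lab e) (tgt e)))
                  (cong₂ _xor_ (arm-bd (mem-end (e , false)) w) (arm-bd (mem-end (e , true)) w))) ⟩
    ((src e ==ᶠ w) xor (tgt e ==ᶠ w)) xor (((src e ==ᶠ w) xor (root ==ᶠ w)) xor ((tgt e ==ᶠ w) xor (root ==ᶠ w)))
      ≡⟨ cancel (src e ==ᶠ w) (tgt e ==ᶠ w) (root ==ᶠ w) ⟩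
    false ∎
    where
    cancel : ∀ s t r → (s xor t) xor ((s xor r) xor (t xor r)) ≡ false
    cancel = solve 3 (λ s t r → (s :+ t) :+ ((s :+ r) :+ (t :+ r)) := con false) refl where open xor-∧-Solver
  cycle-Cycle (inj₂ d) w = trans (add (bd-linear w) (arm (lab (proj₁ d)) (end d)) (arm (Whole.owner (end d)) (end d)))
    (≡⇒xor≡false (trans (arm-bd (mem-end d) w) (sym (arm-bd (Whole.mem-owner (Whole.∈-union {lab (proj₁ d)} refl (mem-end d))) w))))

  module W = Euler Whole.rooted

  -- The arms through the member of `e` occur twice and cancel: each dart generator exchanges such
  -- an arm for the one through the owner of that end.
  fundamental-split : ∀ e → (cycle (inj₁ e) ⊕ (cycle (inj₂ (e , false)) ⊕ cycle (inj₂ (e , true)))) ≗ W.fundamental e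
  fundamental-split e f = cancel (e ==ᶠ f) (arm (lab e) (src e) f) (arm (lab e) (tgt e) f) _ _
    where
    cancel : ∀ x p q s t → (x xor (p xor q)) xor ((p xor s) xor (q xor t)) ≡ x xor (s xor t)
    cancel = solve 5 (λ x p q s t → (x :+ (p :+ q)) :+ ((p :+ s) :+ (q :+ t)) := x :+ (s :+ t)) refl where open xor-∧-Solver

  generators : List Generator
  generators = allFin m ⊞ dartsOf (allFin m)

  generators-complete : ∀ γ → γ ∈ generators
  generators-complete (inj₁ e) = ∈-⊞ˡ (∈-allFin e)
  generators-complete (inj₂ d) = ∈-⊞ʳ {xs = allFin m} (∈-dartsOf⁺ (∈-allFin (proj₁ d)) (proj₂ d))

  open Symplectic {enum = generators} generators-complete public

  form : Form
  form γ γ' = ω (cycle γ) (cycle γ')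

  -- The selection on generators tests against generators, spanning tests fundamental cycles against
  -- fundamental cycles. Each of the latter is a sum of three generators, so bilinearity carries the
  -- relation over in both arguments.
  formSpanning⇒Spanning : ∀ {r} {z : Fin r → Generator} → FormSpanning form z → W.Spanning (cycle ∘ z)
  formSpanning⇒Spanning {r} {z} span = W.fundamental⇒Spanning (cycle ∘ z) λ {e} _ →
    W.InSpan-resp _ (fundamental-split e)
      (W.InSpan-⊕ _ (inSpan (inj₁ e)) (W.InSpan-⊕ _ (inSpan (inj₂ (e , false))) (inSpan (inj₂ (e , true)))))
    where
    c : Generator → Fin r → Bool
    c γ = proj₁ (span γ)

    spanned : ∀ γ → Linear (λ y → ω (cycle γ) y xor sum (λ l → c γ l ∧ ω (cycle (z l)) y))
    spanned γ = linear-xor (ω-linearʳ (cycle γ)) (linear-sum λ l → linear-∧ (c γ l) (ω-linearʳ (cycle (z l))))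

    inSpan : ∀ γ → W.InSpan (cycle ∘ z) (cycle γ)
    inSpan γ = c γ , λ {e} _ → xor≡false⇒≡ (trans (sym (resp L (fundamental-split e)))
      (trans (add L (cycle (inj₁ e)) (cycle (inj₂ (e , false)) ⊕ cycle (inj₂ (e , true))))
      (cong₂ _xor_ (on (inj₁ e)) (trans (add L (cycle (inj₂ (e , false))) (cycle (inj₂ (e , true))))
                                        (cong₂ _xor_ (on (inj₂ (e , false))) (on (inj₂ (e , true))))))))
      where
      L = spanned γ
      on : ∀ γ' → ω (cycle γ) (cycle γ') xor sum (λ l → c γ l ∧ ω (cycle (z l)) (cycle γ')) ≡ false
      on γ' = ≡⇒xor≡false (proj₂ (span γ) γ')

  labels : ∀ {r} → (Fin r → Generator) → List (Fin k)
  labels z = a ∷ tabulate (label₁ ∘ z) ++ tabulate (label₂ ∘ z)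

  length-labels : ∀ {r} (z : Fin r → Generator) → length (labels z) ≡ suc (r + r)
  length-labels z = cong suc (trans (ListP.length-++ (tabulate (label₁ ∘ z)))
    (cong₂ _+_ (ListP.length-tabulate (label₁ ∘ z)) (ListP.length-tabulate (label₂ ∘ z))))

  chosen : ∀ {r} → (Fin r → Generator) → Fin k → Bool
  chosen z i = any (_==ᶠ i) (labels z)

  ∈⇒chosen : ∀ {r} (z : Fin r → Generator) {i} → i ∈ labels z → chosen z i ≡ true
  ∈⇒chosen z i∈ = T⇒≡ (AnyP.any⁺ _ (Any.map (λ eq → ≡⇒==ᶠ (sym eq)) i∈))

  anchor-chosen : ∀ {r} (z : Fin r → Generator) → chosen z a ≡ true
  anchor-chosen z = ∈⇒chosen z (here refl)

  cycle-chosen : ∀ {r} (z : Fin r → Generator) l e → chosen z (lab e) ≡ false → cycle (z l) e ≡ false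
  cycle-chosen z l e ∉ = cycle-supp (z l) e (avoid (here refl))
    (avoid (there (∈-++⁺ˡ (∈-tabulate⁺ l))))
    (avoid (there (∈-++⁺ʳ (tabulate (label₁ ∘ z)) (∈-tabulate⁺ l))))
    where
    avoid : ∀ {i} → i ∈ labels z → lab e ≢ i
    avoid i∈ refl = contradiction (trans (sym (∈⇒chosen z i∈)) ∉) λ ()

-- From the counts to the genus

module _ {n m : ℕ} (G : EmbeddedGraph n m) (VS : Fin n → Bool) (ES : Fin m → Bool) where

  private
    c = numComponents G VS ES
    E = numEdges G VS ES
    V+F = numVertices G VS ES + numFaces G VS ES

  -- Truncated subtraction and halving are monotone, and the number of cycles is even, so nothing is
  -- lost in halving it. This direction rests on having at least one component, the other on having
  -- at most one.
  genus-lower : ∀ g → 1 ≤ c → suc g * 2 + V+F ≤ E + 2 → genus G VS ES > g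
  genus-lower g 1≤c le = subst (_≤ genus G VS ES) (m*n/n≡m (suc g) 2) (/-monoˡ-≤ 2
    (subst (_≤ (2 * c + E) ∸ V+F) (ℕP.m+n∸n≡m (suc g * 2) V+F)
      (ℕP.∸-monoˡ-≤ V+F (ℕP.≤-trans le (ℕP.≤-trans (ℕP.≤-reflexive (ℕP.+-comm E 2)) (ℕP.+-monoˡ-≤ E (ℕP.*-monoʳ-≤ 2 1≤c)))))))

  genus-upper : ∀ {s} → c ≤ 1 → E + 2 ≤ s * 2 + V+F → genus G VS ES ≤ s
  genus-upper {s} c≤1 le = subst (genus G VS ES ≤_) (m*n/n≡m s 2) (/-monoˡ-≤ 2
    (subst ((2 * c + E) ∸ V+F ≤_) (ℕP.m+n∸n≡m (s * 2) V+F)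
      (ℕP.∸-monoˡ-≤ V+F (ℕP.≤-trans (ℕP.+-monoˡ-≤ E (ℕP.*-monoʳ-≤ 2 c≤1)) (ℕP.≤-trans (ℕP.≤-reflexive (ℕP.+-comm 2 E)) le)))))

mainTheorem3 : ∀ {n m k : ℕ} (G : EmbeddedGraph n m) (H : Cluster G k) (g : ℕ) →
    genusUnion H (λ _ → true) > g →
    Σ (Fin k → Bool) (λ S → (count S ≤ 4 * g + 5) × (genusUnion H S > g))
mainTheorem3 {n} {m} {k} G H g genus>g =
  conclude (select (suc g) form (λ γ γ' → ω-symmetric (cycle-Cycle γ)) (λ γ → ω-alternating (cycle-Cycle γ)))
  where
  open Homology G
  open ClusterCycles H

  -- The anchor and two labels for each of the 2g + 2 generators.
  size : suc (suc g * 2 + suc g * 2) ≡ 4 * g + 5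
  size = solve 1 (λ g → con 1 :+ ((con 1 :+ g) :* con 2 :+ (con 1 :+ g) :* con 2) := con 4 :* g :+ con 5) refl g
    where open +-*-Solver

  conclude :
    (∃ λ (z : Fin (suc g * 2) → Generator) → FormNondegenerate form z) ⊎
    (∃ λ s → s < suc g × ∃ λ (z : Fin (s * 2) → Generator) → FormSpanning form z) →
    Σ (Fin k → Bool) (λ S → (count S ≤ 4 * g + 5) × (genusUnion H S > g))
  -- The form is that of the whole graph and the cycles lie in the chosen union, so nondegeneracy
  -- can be used there without change.
  conclude (inj₁ (z , nd)) = chosen z ,
    subst (count (chosen z) ≤_) (trans (length-labels z) size) (count≤length (labels z)) ,
    genus-lower G VS ES g (Components.component-exists G VS ES (Rooted.base∈ rooted))
      (Euler.nondegenerate⇒≤ rooted (cycle ∘ z) (cycle-chosen z) (cycle-Cycle ∘ z) nd)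
    where open Sub (chosen z) (anchor-chosen z)
  -- At most g pairs spanning the form of the whole cluster would bound its genus by g, against the
  -- hypothesis.
  conclude (inj₂ (s , s<t , z , span)) = contradiction
    (ℕP.≤-trans genus>g (genus-upper G VS ES (Components.component-unique G VS ES union-connected)
      (W.spanning⇒≤ (cycle ∘ z) (λ _ _ ()) (cycle-Cycle ∘ z) (formSpanning⇒Spanning {z = z} span))))
    (ℕP.<⇒≱ s<t)
    where open Whole
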